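{- For every positive integer $n$, $$R_7(n)=8\sigma(n)-32\sigma\left(\tfrac{n}{4}\right)+8\sigma\left(\tfrac{n}{7}\right)-32\sigma\left(\tfrac{n}{28}\right)+64\,W_{1,7}(n)+1024\,W_{1,7}\left(\tfrac{n}{4}\right)-256\left(W_{4,7}(n)+W_{1,28}(n)\right).$$
   Context: For $n\in\mathbb{N}=\{1,2,3,\dots\}$, $\sigma(n)=\sum_{d\mid n}d$ (sum over positive divisors), and $\sigma(x)=0$ if $x\notin\mathbb{N}$. For $a,b\in\mathbb{N}$ with $a\le b$, the convolution sum is $$W_{a,b}(n)=\sum_{(l,m)\in\mathbb{N}^2,\ al+bm=n}\sigma(l)\sigma(m),$$ and $W_{a,b}(x)=0$ if $x\notin\mathbb{N}$ (the defining sum is then empty). For $n\in\mathbb{N}$, $R_7(n)$ is the number of $(x_1,\dots,x_8)\in\mathbb{Z}^8$ with $$n=x_1^2+x_2^2+x_3^2+x_4^2+7(x_5^2+x_6^2+x_7^2+x_8^2).$$ -}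

module Defs where

open import Data.Fin.Base using (Fin)
open import Data.Integer.Base as ℤ using (ℤ; +_; +[1+_]; _^_)
open import Data.List.Base using (List; applyUpTo; cartesianProduct; filter; map)
open import Data.Nat.Base using (ℕ; suc; _+_; _*_; NonZero)
open import Data.Nat.Divisibility using (_∣?_)
open import Data.Nat.ListAction using (sum)
open import Data.Nat.Properties using (_≟_)
open import Data.Product.Base using (Σ-syntax; _×_; _,_)
open import Data.Rational.Base using (ℚ; mkℚ)
open import Data.Vec.Base using (Vec; []; _∷_)
open import Function.Bundles using (_↔_)
open import Relation.Binary.PropositionalEquality.Core using (_≡_)

[1⋯_] : ℕ → List ℕ
[1⋯ n ] = applyUpTo suc n

σ : ℕ → ℕ
σ n = sum (filter (_∣? n) [1⋯ n ])

-- The sum over all pairs (l , m) of positive integers with a l + b m = n.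
-- As a and b are positive, such a pair satisfies l ≤ n and m ≤ n, so the
-- bounded enumeration loses nothing.
W : (a b : ℕ) .{{_ : NonZero a}} .{{_ : NonZero b}} → ℕ → ℕ
W a b n =
  sum (map (λ (l , m) → σ l * σ m)
           (filter (λ (l , m) → a * l + b * m ≟ n)
                   (cartesianProduct [1⋯ n ] [1⋯ n ])))

-- Extension by 0 of a function on {1, 2, 3, …} to the rationals: elements of ℚ
-- are in lowest terms, and the second field of mkℚ is the denominator minus
-- one, so the first clause matches exactly the positive integers.
zeroExtend : (ℕ → ℕ) → ℚ → ℕ
zeroExtend f (mkℚ +[1+ k ] 0 _) = f (suc k)
zeroExtend f _                  = 0

form₇ : Vec ℤ 8 → ℤ
form₇ (x₁ ∷ x₂ ∷ x₃ ∷ x₄ ∷ x₅ ∷ x₆ ∷ x₇ ∷ x₈ ∷ []) =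
  x₁ ^ 2 ℤ.+ x₂ ^ 2 ℤ.+ x₃ ^ 2 ℤ.+ x₄ ^ 2
    ℤ.+ + 7 ℤ.* (x₅ ^ 2 ℤ.+ x₆ ^ 2 ℤ.+ x₇ ^ 2 ℤ.+ x₈ ^ 2)

-- Equality of integers is proof-irrelevant, so elements of this type correspond
-- to the solution vectors themselves.
Representation₇ : ℕ → Set
Representation₇ n = Σ[ x ∈ Vec ℤ 8 ] + n ≡ form₇ x

-- "R₇ n is r" says that there are exactly r representations; such an r is
-- unique because Fin r ↔ Fin s forces r ≡ s.
R₇_is_ : ℕ → ℕ → Set
R₇ n is r = Representation₇ n ↔ Fin r

-- Expanding R₇ = r₄ * r₄(·/7) reduces the formula to Jacobi's four square theorem
-- r₄(n) = 8 σ(n) − 32 σ(n/4) for n ≥ 1, r₄(0) = 1. A sequence a is determined by a(0) and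
-- ∑ (n − 5 m²) a(n − m²) = 0 for all n ≥ 1, the sum running over the integers m.
-- For r₄ the left side sums n − 5 x₁² over the vectors of norm n in ℤ⁵, and vanishes because all
-- coordinates contribute equally.
-- For the divisor sums one sums (t² d e − 4 m²) d over the triples with d , e > 0 and
-- m² + t² d e = n, for t = 1 , 2. By symmetry this may be replaced by the product
-- G = t (d + e) (t d + 2 m) (t e − 2 m), which changes sign under the Zagier-type involution
-- (m , d , e) ↦ (− m − t d , d , e − (2 / t) m − d) wherever that keeps e positive. Only the
-- triples with e = (2 / t) m + d survive; they exist only if n is a square, and are summed explicitly.
{-# OPTIONS --safe #-}
module Submission where

open import Defs
open import Data.Empty using (⊥-elim-irr)
open import Data.Fin.Base as Fin using (Fin)
open import Data.Integer.Base using (ℤ; +_; -[1+_]; +[1+_]; ∣_∣; _+_; _-_; _*_; _^_; -_; 0ℤ; _<_; +<+)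
import Data.Integer.GCD as ℤ
import Data.Integer.Properties as ℤ
open import Data.Integer.Tactic.RingSolver using (solve-∀)
open import Data.List.Base using (List; []; _∷_; _++_; map; filter; concatMap; cartesianProduct; downFrom; length; lookup)
open import Data.List.Membership.Propositional using (_∈_; find; lose)
open import Data.List.Membership.Propositional.Properties
open import Data.List.Membership.Propositional.Properties.WithK using (unique∧set⇒bag; unique⇒irrelevant)
open import Data.List.Properties using (map-id)
open import Data.List.Relation.Binary.BagAndSetEquality using (∼bag⇒↭)
open import Data.List.Relation.Binary.Disjoint.Propositional using (Disjoint)
open import Data.List.Relation.Binary.Permutation.Propositional as ↭ using (_↭_)
open import Data.List.Relation.Unary.All as All using ([]; _∷_)
import Data.List.Relation.Unary.All.Properties as All
open import Data.List.Relation.Unary.AllPairs as AllPairs using ([]; _∷_)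
import Data.List.Relation.Unary.AllPairs.Properties as AllPairs
open import Data.List.Relation.Unary.Any using (here; there; index)
open import Data.List.Relation.Unary.Any.Properties using (lookup-index)
open import Data.List.Relation.Unary.Unique.Propositional using (Unique)
import Data.List.Relation.Unary.Unique.Propositional.Properties as Unique
open import Data.Nat.Base as ℕ using (ℕ; zero; suc; NonZero; z≤n; s≤s)
open import Data.Nat.Divisibility using (_∣_; _∣?_; divides)
open import Data.Nat.Induction using (<-rec)
open import Data.Nat.ListAction using (sum)
import Data.Nat.Properties as ℕ
import Data.Nat.Tactic.RingSolver as ℕRing
open import Data.Product.Base as Product using (Σ; ∃-syntax; _×_; _,_; proj₁; proj₂)
open import Data.Product.Properties using (≡-dec)
open import Data.Rational.Base using (ℚ; mkℚ; ↥_; ↧_; _/_)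
open import Data.Rational.Properties using (↥-/; ↧-/)
open import Data.Sum.Base using (_⊎_; inj₁; inj₂)
open import Data.Vec.Base as Vec using (Vec; []; _∷_)
open import Function.Base using (_∘_; id; it)
open import Function.Bundles using (_↔_; mk⇔; mk↔ₛ′)
open import Relation.Binary.Definitions using (DecidableEquality; tri<; tri≈; tri>)
open import Relation.Binary.PropositionalEquality
open import Relation.Binary.PropositionalEquality.WithK using (≡-irrelevant)
open import Relation.Nullary using (¬_; Dec; yes; no; contradiction; ¬?)
open import Relation.Nullary.Decidable using (_×-dec_)
open import Relation.Unary using (Decidable)

-- The product `G` comes from geometry. Attach to (m , d , e) the binary form f(X , Y) = t d X² + 2
-- m X Y - t e Y², whose determinant is -n. Its values at (1 , 0), (0 , 1), (1 , 1) are t d, -t e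
-- and t d + 2 m - t e, and `G` is (f(1 , 0) - f(0 , 1)) (f(1 , 1) - f(0 , 1)) (f(1 , 0) - f(1 ,
-- 1)), a Vandermonde product. The involution is a change of basis that fixes the first value and
-- exchanges the other two, hence the change of sign. As r t = 2, the value at (1 , 1) is -t times
-- `gap`. The involution serves the forms that are negative there; passing to -f(Y , X) brings the
-- positive ones to that case. What is left are the forms with f(1 , 1) = 0, and a form of
-- determinant -n with such a zero makes n a square. Neither divisor sum satisfies the recurrence
-- alone: for square n both closed forms contain n², and only the combination with 8 and -32 removes
-- it.

private variable
  X Y : Set
  P P′ : X → Set
  Q : Y → Set

-- Finite sums over enumerated predicates

∑ˡ : List X → (X → ℤ) → ℤ
∑ˡ []       h = 0ℤ
∑ˡ (x ∷ xs) h = h x + ∑ˡ xs h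

∑ˡ-↭ : (h : X → ℤ) {xs ys : List X} → xs ↭ ys → ∑ˡ xs h ≡ ∑ˡ ys h
∑ˡ-↭ h ↭.refl         = refl
∑ˡ-↭ h (↭.prep x p)   = cong (_+_ (h x)) (∑ˡ-↭ h p)
∑ˡ-↭ h (↭.swap x y p) = trans (cong (λ s → h x + (h y + s)) (∑ˡ-↭ h p)) (exchange (h x) (h y) _)
  where
  exchange : ∀ a b c → a + (b + c) ≡ b + (a + c)
  exchange = solve-∀
∑ˡ-↭ h (↭.trans p q)  = trans (∑ˡ-↭ h p) (∑ˡ-↭ h q)

∑ˡ-cong : {g h : X → ℤ} (xs : List X) → (∀ {x} → x ∈ xs → g x ≡ h x) → ∑ˡ xs g ≡ ∑ˡ xs h
∑ˡ-cong []       eq = refl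
∑ˡ-cong (x ∷ xs) eq = cong₂ _+_ (eq (here refl)) (∑ˡ-cong xs (eq ∘ there))

∑ˡ-++ : (h : X → ℤ) (xs ys : List X) → ∑ˡ (xs ++ ys) h ≡ ∑ˡ xs h + ∑ˡ ys h
∑ˡ-++ h []       ys = sym (ℤ.+-identityˡ _)
∑ˡ-++ h (x ∷ xs) ys = trans (cong (_+_ (h x)) (∑ˡ-++ h xs ys)) (sym (ℤ.+-assoc (h x) _ _))

∑ˡ-map : (h : Y → ℤ) (f : X → Y) (xs : List X) → ∑ˡ (map f xs) h ≡ ∑ˡ xs (h ∘ f)
∑ˡ-map h f []       = refl
∑ˡ-map h f (x ∷ xs) = cong (_+_ (h (f x))) (∑ˡ-map h f xs)

∑ˡ-concatMap : (h : Y → ℤ) (f : X → List Y) (xs : List X) →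
               ∑ˡ (concatMap f xs) h ≡ ∑ˡ xs (λ x → ∑ˡ (f x) h)
∑ˡ-concatMap h f []       = refl
∑ˡ-concatMap h f (x ∷ xs) =
  trans (∑ˡ-++ h (f x) _) (cong (_+_ (∑ˡ (f x) h)) (∑ˡ-concatMap h f xs))

∑ˡ-linear : (a b : ℤ) (g h : X → ℤ) (xs : List X) →
            ∑ˡ xs (λ x → a * g x + b * h x) ≡ a * ∑ˡ xs g + b * ∑ˡ xs h
∑ˡ-linear a b g h []       = sym (zeros a b)
  where
  zeros : ∀ a b → a * 0ℤ + b * 0ℤ ≡ 0ℤ
  zeros = solve-∀
∑ˡ-linear a b g h (x ∷ xs) =
  trans (cong (_+_ (a * g x + b * h x)) (∑ˡ-linear a b g h xs)) (regroup a b (g x) (h x) _ _)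
  where
  regroup : ∀ a b u v s t → a * u + b * v + (a * s + b * t) ≡ a * (u + s) + b * (v + t)
  regroup = solve-∀

∑ˡ-filter : {S : X → Set} (S? : Decidable S) (h : X → ℤ) (xs : List X) →
            ∑ˡ xs h ≡ ∑ˡ (filter S? xs) h + ∑ˡ (filter (¬? ∘ S?) xs) h
∑ˡ-filter S? h [] = refl
∑ˡ-filter S? h (x ∷ xs) with S? x
... | yes _ = trans (cong (_+_ (h x)) (∑ˡ-filter S? h xs)) (sym (ℤ.+-assoc (h x) _ _))
... | no  _ = trans (cong (_+_ (h x)) (∑ˡ-filter S? h xs))
  (exchange (h x) (∑ˡ (filter S? xs) h) (∑ˡ (filter (¬? ∘ S?) xs) h))
  where
  exchange : ∀ a b c → a + (b + c) ≡ b + (a + c)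
  exchange = solve-∀

-- A finite set is represented by its defining predicate, the list being only a witness. By
-- `∑-unique` a sum depends on the predicate alone, so later rearrangements are equivalences or
-- bijections of predicates and never concern the order of a list.
record Enumeration {X : Set} (P : X → Set) : Set where
  field
    elements : List X
    unique   : Unique elements
    sound    : ∀ {x} → x ∈ elements → P x
    complete : ∀ {x} → P x → x ∈ elements

open Enumeration

∑ : Enumeration P → (_ → ℤ) → ℤ
∑ E = ∑ˡ (elements E)

∑-unique : (E F : Enumeration P) (h : _ → ℤ) → ∑ E h ≡ ∑ F h
∑-unique E F h = ∑ˡ-↭ h (∼bag⇒↭ (unique∧set⇒bag (unique E) (unique F)
  (mk⇔ (complete F ∘ sound E) (complete E ∘ sound F))))

∑-cong : (E : Enumeration P) {g h : _ → ℤ} → (∀ x → P x → g x ≡ h x) → ∑ E g ≡ ∑ E h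
∑-cong E eq = ∑ˡ-cong (elements E) (λ x∈ → eq _ (sound E x∈))

∑-zero : (E : Enumeration P) {h : _ → ℤ} → (∀ x → P x → h x ≡ 0ℤ) → ∑ E h ≡ 0ℤ
∑-zero E eq = trans (∑-cong E eq) (zeros (elements E))
  where
  zeros : (xs : List X) → ∑ˡ xs (λ _ → 0ℤ) ≡ 0ℤ
  zeros []       = refl
  zeros (x ∷ xs) = trans (ℤ.+-identityˡ _) (zeros xs)

∑-linear : (E : Enumeration P) (a b : ℤ) (g h : _ → ℤ) →
           ∑ E (λ x → a * g x + b * h x) ≡ a * ∑ E g + b * ∑ E h
∑-linear E a b g h = ∑ˡ-linear a b g h (elements E)

∑-scale : (E : Enumeration P) (a : ℤ) (g : _ → ℤ) → ∑ E (λ x → a * g x) ≡ a * ∑ E g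
∑-scale E a g =
  trans (∑-cong E (λ x _ → pad a (g x))) (trans (∑-linear E a 0ℤ g g) (sym (pad a (∑ E g))))
  where
  pad : ∀ a u → a * u ≡ a * u + 0ℤ * u
  pad = solve-∀

∑-plus : (E : Enumeration P) (g h : _ → ℤ) → ∑ E (λ x → g x + h x) ≡ ∑ E g + ∑ E h
∑-plus E g h =
  trans (∑-cong E (λ x _ → ones (g x) (h x)))
    (trans (∑-linear E (+ 1) (+ 1) g h) (sym (ones (∑ E g) (∑ E h))))
  where
  ones : ∀ u v → u + v ≡ + 1 * u + + 1 * v
  ones = solve-∀

reEnumerate : (∀ {x} → P x → P′ x) → (∀ {x} → P′ x → P x) → Enumeration P → Enumeration P′
reEnumerate to from E = record
  { elements = elements E
  ; unique   = unique E
  ; sound    = to ∘ sound E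
  ; complete = complete E ∘ from
  }

restrict : {S : X → Set} → Enumeration P → Decidable S → Enumeration (λ x → P x × S x)
restrict E S? = record
  { elements = filter S? (elements E)
  ; unique   = Unique.filter⁺ S? (unique E)
  ; sound    = λ x∈ → let x∈E , s = ∈-filter⁻ S? {xs = elements E} x∈ in sound E x∈E , s
  ; complete = λ (p , s) → ∈-filter⁺ S? (complete E p) s
  }

∑-split : {S : X → Set} (E : Enumeration P) (S? : Decidable S) (h : X → ℤ) →
          ∑ E h ≡ ∑ (restrict E S?) h + ∑ (restrict E (¬? ∘ S?)) h
∑-split E S? h = ∑ˡ-filter S? h (elements E)

-- All conditions are relative to `P` and `Q`. Thus a projection such as `proj₂` qualifies as soon
-- as `P` determines the forgotten component.
record Bijection {X Y : Set} (P : X → Set) (Q : Y → Set) (f : X → Y) : Set where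
  field
    into      : ∀ {x} → P x → Q (f x)
    injective : ∀ {x y} → P x → P y → f x ≡ f y → x ≡ y
    onto      : ∀ {y} → Q y → ∃[ x ] P x × f x ≡ y

inverse⇒bijection : {X Y : Set} {P : X → Set} {Q : Y → Set} (f : X → Y) (g : Y → X) →
                    (∀ x → P x → Q (f x)) → (∀ y → Q y → P (g y)) →
                    (∀ x → P x → g (f x) ≡ x) → (∀ y → Q y → f (g y) ≡ y) →
                    Bijection P Q f
inverse⇒bijection f g to from gf fg = record
  { into      = to _
  ; injective = λ p q eq → trans (sym (gf _ p)) (trans (cong g eq) (gf _ q))
  ; onto      = λ q → g _ , from _ q , fg _ q
  }

unique-map : {f : X → Y} {xs : List X} → (∀ {x y} → P x → P y → f x ≡ f y → x ≡ y) →
             (∀ {x} → x ∈ xs → P x) → Unique xs → Unique (map f xs)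
unique-map inj ps []         = []
unique-map inj ps (nx ∷ nxs) =
  All.map⁺ (All.tabulate λ y∈ eq → All.lookup nx y∈ (inj (ps (here refl)) (ps (there y∈)) eq))
  ∷ unique-map inj (ps ∘ there) nxs

image : {f : X → Y} → Bijection P Q f → Enumeration P → Enumeration Q
image {Q = Q} {f = f} b E = record
  { elements = map f (elements E)
  ; unique   = unique-map (Bijection.injective b) (sound E) (unique E)
  ; sound    = λ y∈ → let x , x∈ , eq = ∈-map⁻ f y∈ in
                 subst Q (sym eq) (Bijection.into b (sound E x∈))
  ; complete = λ q → let x , p , eq = Bijection.onto b q in
                 subst (_∈ _) eq (∈-map⁺ f (complete E p))
  }

∑-image : {f : X → Y} (b : Bijection P Q f) (E : Enumeration P) (h : Y → ℤ) →
          ∑ (image b E) h ≡ ∑ E (h ∘ f)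
∑-image {f = f} b E h = ∑ˡ-map h f (elements E)

∑-reindex : {f : X → Y} → Bijection P Q f → (E : Enumeration P) (F : Enumeration Q) (h : Y → ℤ) →
            ∑ E (h ∘ f) ≡ ∑ F h
∑-reindex b E F h = trans (sym (∑-image b E h)) (∑-unique (image b E) F h)

∑-support : (E : Enumeration P) (F : Enumeration P′) → Decidable P′ → (∀ {x} → P′ x → P x) →
            (h : _ → ℤ) → (∀ x → P x → ¬ P′ x → h x ≡ 0ℤ) → ∑ E h ≡ ∑ F h
∑-support E F P′? inc h vanish = begin
  ∑ E h                                                 ≡⟨ ∑-split E P′? h ⟩
  ∑ (restrict E P′?) h + ∑ (restrict E (¬? ∘ P′?)) h    ≡⟨ cong₂ _+_
    (∑-unique (restrict E P′?) (reEnumerate (λ p → inc p , p) proj₂ F) h)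
    (∑-zero (restrict E (¬? ∘ P′?)) (λ x (p , ¬p′) → vanish x p ¬p′)) ⟩
  ∑ F h + 0ℤ                                            ≡⟨ ℤ.+-identityʳ _ ⟩
  ∑ F h                                                 ∎
  where open ≡-Reasoning

singleton : (x₀ : X) → Enumeration (_≡ x₀)
singleton x₀ = record
  { elements = x₀ ∷ []
  ; unique   = [] ∷ []
  ; sound    = λ { (here eq) → eq }
  ; complete = here
  }

∑-single : {P : X → Set} (E : Enumeration P) → DecidableEquality X → (x₀ : X) → P x₀ → (h : X → ℤ) →
           (∀ x → P x → x ≢ x₀ → h x ≡ 0ℤ) → ∑ E h ≡ h x₀
∑-single {P = P} E _≟_ x₀ p h vanish =
  trans (∑-support E (singleton x₀) (_≟ x₀) (λ eq → subst P (sym eq) p) h vanish) (ℤ.+-identityʳ _)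

pairs : {Q : X → Y → Set} → Enumeration P → (∀ x → Enumeration (Q x)) →
        Enumeration (λ ((x , y) : X × Y) → P x × Q x y)
pairs {X = X} {Y = Y} {P = P} {Q = Q} E F = record
  { elements = concatMap fibre (elements E)
  ; unique   = Unique.concat⁺ (All.map⁺ (All.tabulate λ _ → Unique.map⁺ (cong proj₂) (unique (F _))))
                 (AllPairs.map⁺ (AllPairs.map disjoint (unique E)))
  ; sound    = λ xy∈ → let x , x∈ , xy∈′ = find (∈-concatMap⁻ fibre xy∈)
                           y , y∈ , eq = ∈-map⁻ (_,_ x) xy∈′
                       in subst (λ (x , y) → P x × Q x y) (sym eq) (sound E x∈ , sound (F x) y∈)
  ; complete = λ (p , q) → ∈-concatMap⁺ fibre (lose (complete E p) (∈-map⁺ (_,_ _) (complete (F _) q)))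
  }
  where
  fibre : X → List (X × Y)
  fibre x = map (_,_ x) (elements (F x))

  disjoint : ∀ {x x′} → x ≢ x′ → Disjoint (fibre x) (fibre x′)
  disjoint x≢x′ (v∈ , v∈′) =
    let _ , _ , eq  = ∈-map⁻ (_,_ _) v∈
        _ , _ , eq′ = ∈-map⁻ (_,_ _) v∈′
    in x≢x′ (cong proj₁ (trans (sym eq) eq′))

∑-pairs : {Q : X → Y → Set} (E : Enumeration P) (F : ∀ x → Enumeration (Q x)) (h : X × Y → ℤ) →
          ∑ (pairs E F) h ≡ ∑ E (λ x → ∑ (F x) (λ y → h (x , y)))
∑-pairs E F h = trans (∑ˡ-concatMap h _ (elements E))
  (∑ˡ-cong (elements E) (λ {x} _ → ∑ˡ-map h (_,_ x) (elements (F x))))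

-- Reindexing along `f` shows that the sum is its own negative. Fixed points are harmless, since
-- oddness makes `h` vanish at them.
∑-involution : {P : X → Set} (E : Enumeration P) (f : X → X) → (∀ x → P x → P (f x)) →
               (∀ x → P x → f (f x) ≡ x) → (h : X → ℤ) →
               (∀ x → P x → h (f x) ≡ - h x) → ∑ E h ≡ 0ℤ
∑-involution E f into invol h odd = selfNegating (begin
  ∑ E h                   ≡⟨ ∑-reindex (inverse⇒bijection f f into into invol invol) E E h ⟨
  ∑ E (h ∘ f)             ≡⟨ ∑-cong E (λ x p → trans (odd x p) (sym (ℤ.-1*i≡-i (h x)))) ⟩
  ∑ E (λ x → - + 1 * h x) ≡⟨ ∑-scale E (- + 1) h ⟩
  - + 1 * ∑ E h           ≡⟨ ℤ.-1*i≡-i (∑ E h) ⟩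
  - ∑ E h                 ∎)
  where
  open ≡-Reasoning
  selfNegating : ∀ {i} → i ≡ - i → i ≡ 0ℤ
  selfNegating {+ zero}  eq = refl

-- Enumerating bounded integers, square decompositions and factorisations

below : (N : ℕ) → Enumeration (ℕ._< N)
below N = record
  { elements = downFrom N
  ; unique   = Unique.downFrom⁺ N
  ; sound    = ∈-downFrom⁻
  ; complete = ∈-downFrom⁺
  }

boundedPairs : {S : ℕ × ℕ → Set} (N : ℕ) → Decidable S →
               (∀ {x y} → S (x , y) → x ℕ.< N × y ℕ.< N) → Enumeration S
boundedPairs N S? bound =
  reEnumerate proj₂ (λ s → bound s , s) (restrict (pairs (below N) (λ _ → below N)) S?)

integers : (N : ℕ) → Enumeration (λ m → ∣ m ∣ ℕ.≤ N)
integers N = record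
  { elements = nonneg ++ neg
  ; unique   = Unique.++⁺ (Unique.map⁺ ℤ.+-injective (Unique.downFrom⁺ (suc N)))
                 (Unique.map⁺ ℤ.-[1+-injective (Unique.downFrom⁺ N)) disjoint
  ; sound    = sound′ ∘ ∈-++⁻ nonneg
  ; complete = complete′
  }
  where
  nonneg neg : List ℤ
  nonneg = map +_ (downFrom (suc N))
  -- The absolute value of `-[1+ i ]` is i + 1, so i ranges below N here, but below N + 1 for the
  -- nonnegative half.
  neg    = map -[1+_] (downFrom N)

  disjoint : ∀ {m} → ¬ (m ∈ nonneg × m ∈ neg)
  disjoint (p , q) with ∈-map⁻ +_ p | ∈-map⁻ -[1+_] q
  ... | _ , _ , refl | _ , _ , ()

  sound′ : ∀ {m} → m ∈ nonneg ⊎ m ∈ neg → ∣ m ∣ ℕ.≤ N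
  sound′ (inj₁ p) with _ , i< , refl ← ∈-map⁻ +_ p = ℕ.≤-pred (∈-downFrom⁻ i<)
  sound′ (inj₂ q) with _ , i< , refl ← ∈-map⁻ -[1+_] q = ∈-downFrom⁻ i<

  complete′ : ∀ {m} → ∣ m ∣ ℕ.≤ N → m ∈ nonneg ++ neg
  complete′ {+ _}      le = ∈-++⁺ˡ (∈-map⁺ +_ (∈-downFrom⁺ (s≤s le)))
  complete′ { -[1+ _ ]} le = ∈-++⁺ʳ nonneg (∈-map⁺ -[1+_] (∈-downFrom⁺ le))

sq : ℤ → ℕ
sq m = ∣ m ∣ ℕ.* ∣ m ∣

+sq : ∀ m → + sq m ≡ m * m
+sq (+ k)    = ℤ.pos-* k k
+sq -[1+ k ] = refl

∣m∣≤sq : ∀ m → ∣ m ∣ ℕ.≤ sq m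
∣m∣≤sq m with ∣ m ∣
... | zero  = z≤n
... | suc k = ℕ.m≤m*n (suc k) (suc k)

-- The remainder k is carried along with an equation, which avoids truncated subtraction: k is
-- directly the index of a coefficient, and the equation can be matched with `refl`.
SquarePlus : ℕ → ℤ × ℕ → Set
SquarePlus n (m , k) = sq m ℕ.+ k ≡ n

squares : (n : ℕ) → Enumeration (SquarePlus n)
squares n = image (inverse⇒bijection (λ m → m , n ℕ.∸ sq m) proj₁ (λ _ → ℕ.m+[n∸m]≡n)
             from (λ _ _ → refl) right)
  (reEnumerate proj₂ (λ {m} le → ℕ.≤-trans (∣m∣≤sq m) le , le)
    (restrict (integers n) (λ m → sq m ℕ.≤? n)))
  where
  from : ∀ mk → SquarePlus n mk → sq (proj₁ mk) ℕ.≤ n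
  from _ refl = ℕ.m≤m+n _ _

  right : ∀ mk → SquarePlus n mk → (proj₁ mk , n ℕ.∸ sq (proj₁ mk)) ≡ mk
  right (m , k) refl = cong (_,_ m) (ℕ.m+n∸m≡n (sq m) k)

Factors : (c k : ℕ) → ℕ × ℕ → Set
Factors c k (d , e) = c ℕ.* (suc d ℕ.* suc e) ≡ k

-- The pair (d , e) stands for the factorisation k = c (d + 1) (e + 1); in particular 0 has none.
factorisations : (c : ℕ) .{{_ : NonZero c}} (k : ℕ) → Enumeration (Factors c k)
factorisations c k = boundedPairs k (λ (d , e) → c ℕ.* (suc d ℕ.* suc e) ℕ.≟ k) bound
  where
  bound : ∀ {d e} → c ℕ.* (suc d ℕ.* suc e) ≡ k → d ℕ.< k × e ℕ.< k
  bound {d} {e} refl = ℕ.≤-trans (ℕ.m≤m*n (suc d) (suc e)) (ℕ.m≤n*m _ c)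
                     , ℕ.≤-trans (ℕ.m≤n*m (suc e) (suc d)) (ℕ.m≤n*m _ c)

ς : (c : ℕ) .{{_ : NonZero c}} → ℕ → ℤ
ς c k = ∑ (factorisations c k) (λ (d , e) → +[1+ d ])

-- Auxiliary facts on order, squares and a power sum

0<j-i : ∀ i j → i < j → 0ℤ < j - i
0<j-i i j i<j = subst (_< j - i) (ℤ.+-inverseʳ i) (ℤ.+-monoˡ-< (- i) i<j)

0<j-i⇒i<j : ∀ i j → 0ℤ < j - i → i < j
0<j-i⇒i<j i j 0<j-i = subst₂ _<_ (ℤ.+-identityˡ i) (cancel i j) (ℤ.+-monoˡ-< i 0<j-i)
  where
  cancel : ∀ i j → j - i + i ≡ j
  cancel = solve-∀

square-injective : ∀ a b → a ℕ.* a ≡ b ℕ.* b → a ≡ b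
square-injective a b eq with ℕ.<-cmp a b
... | tri< a<b _ _ = contradiction eq (ℕ.<⇒≢ (ℕ.*-mono-< a<b a<b))
... | tri≈ _ a≡b _ = a≡b
... | tri> _ _ b<a = contradiction (sym eq) (ℕ.<⇒≢ (ℕ.*-mono-< b<a b<a))

-- `N` is kept independent of `M` so that induction on `M` applies; for M = N - 1 the right side
-- becomes N³ - N. The factor 6 clears the denominators of the sums of d and of d².
∑-product-complement : ∀ N M → + 6 * ∑ (below M) (λ d → +[1+ d ] * (N - +[1+ d ]))
                 ≡ + M * (+ M + + 1) * (+ 3 * N - + 2 * + M - + 1)
∑-product-complement N zero    = refl
∑-product-complement N (suc M) = begin
  + 6 * (S * (N - S) + ∑ (below M) _)                                    ≡⟨ ℤ.*-distribˡ-+ (+ 6) (S * (N - S)) _ ⟩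
  + 6 * (S * (N - S)) + + 6 * ∑ (below M) _                              ≡⟨ cong₂ (λ S s → + 6 * (S * (N - S)) + s)
    (ℤ.+-comm (+ 1) (+ M)) (∑-product-complement N M) ⟩
  + 6 * (S′ * (N - S′)) + + M * S′ * (+ 3 * N - + 2 * + M - + 1)         ≡⟨ step (+ M) N ⟩
  S′ * (S′ + + 1) * (+ 3 * N - + 2 * S′ - + 1)                           ≡⟨ cong (λ S → S * (S + + 1) * (+ 3 * N - + 2 * S - + 1))
    (ℤ.+-comm (+ M) (+ 1)) ⟩
  S * (S + + 1) * (+ 3 * N - + 2 * S - + 1)                              ∎
  where
  open ≡-Reasoning
  S S′ : ℤ
  S  = +[1+ M ]
  S′ = + M + + 1
  step : ∀ M N → + 6 * ((M + + 1) * (N - (M + + 1))) + M * (M + + 1) * (+ 3 * N - + 2 * M - + 1)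
                 ≡ (M + + 1) * (M + + 1 + + 1) * (+ 3 * N - + 2 * (M + + 1) - + 1)
  step = solve-∀

-- The descent on triples

-- As r = 2 / t, the polynomial identities below hold only modulo r t = 2; t = 1 leads to the
-- sum ς 1 of all divisors of k, t = 2 to ς 4, the sum of the divisors of k / 4.
module Descent (t r : ℕ) (rt≡2 : r ℕ.* t ≡ 2) (n : ℕ) where

  τ ρ : ℤ
  τ = + t
  ρ = + r

  ρτ≡2 : ρ * τ ≡ + 2
  ρτ≡2 = trans (sym (ℤ.pos-* r t)) (cong +_ rt≡2)

  -- The shape a ≡ b + (2 − r t) c is what the ring solver can prove of an identity modulo r t = 2.
  modulo : ∀ a b c → a ≡ b + (+ 2 - ρ * τ) * c → a ≡ b
  modulo a b c eq = trans eq (trans (cong (λ z → b + (+ 2 - z) * c) ρτ≡2) (ℤ.+-identityʳ b))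

  instance
    t-nonZero : NonZero t
    t-nonZero = ℕ.m*n≢0⇒n≢0 r {{subst NonZero (sym rt≡2) _}}
    r-nonZero : NonZero r
    r-nonZero = ℕ.m*n≢0⇒m≢0 r {{subst NonZero (sym rt≡2) _}}
    t²-nonZero : NonZero (t ℕ.* t)
    t²-nonZero = ℕ.m*n≢0 t t

  -- The entries are integers with positivity as a separate condition, because the last entry of a
  -- sheared triple is a difference that may fail to be positive.
  Triple : ℤ × ℤ × ℤ → Set
  Triple (m , d , e) = 0ℤ < d × 0ℤ < e × m * m + τ * τ * (d * e) ≡ + n

  private
    toTriple : (ℤ × ℕ) × (ℕ × ℕ) → ℤ × ℤ × ℤ
    toTriple ((m , k) , (d , e)) = m , +[1+ d ] , +[1+ e ]

    cast : ∀ m d e → + (sq m ℕ.+ t ℕ.* t ℕ.* (suc d ℕ.* suc e)) ≡ m * m + τ * τ * (+[1+ d ] * +[1+ e ])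
    cast m d e = cong₂ _+_ (+sq m) (trans (ℤ.pos-* (t ℕ.* t) _) (cong₂ _*_ (ℤ.pos-* t t) (ℤ.pos-* (suc d) (suc e))))

    toTriple-bijection : Bijection (λ (mk , de) → SquarePlus n mk × Factors (t ℕ.* t) (proj₂ mk) de) Triple toTriple
    toTriple-bijection = record
      { into      = λ { {(m , _) , (d , e)} (eq , refl) →
                        +<+ (s≤s z≤n) , +<+ (s≤s z≤n) , trans (sym (cast m d e)) (cong +_ eq) }
      ; injective = λ { (_ , refl) (_ , refl) refl → refl }
      ; onto      = λ { {m , +[1+ d ] , +[1+ e ]} (+<+ _ , +<+ _ , eq) →
                        ((m , t ℕ.* t ℕ.* (suc d ℕ.* suc e)) , (d , e))
                        , (ℤ.+-injective (trans (cast m d e) eq) , refl) , refl }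
      }

    decompositions : Enumeration (λ (mk , de) → SquarePlus n mk × Factors (t ℕ.* t) (proj₂ mk) de)
    decompositions = pairs (squares n) (λ (m , k) → factorisations (t ℕ.* t) k)

  triples : Enumeration Triple
  triples = image toTriple-bijection decompositions

  swap : ℤ × ℤ × ℤ → ℤ × ℤ × ℤ
  swap (m , d , e) = - m , e , d

  swap-swap : ∀ x → swap (swap x) ≡ x
  swap-swap (m , d , e) = cong (λ m′ → m′ , d , e) (ℤ.neg-involutive m)

  swap-triple : ∀ x → Triple x → Triple (swap x)
  swap-triple (m , d , e) (0<d , 0<e , eq) = 0<e , 0<d , trans (identity τ m d e) eq
    where
    identity : ∀ t m d e → - m * - m + t * t * (e * d) ≡ m * m + t * t * (d * e)
    identity = solve-∀

  reflect : ℤ × ℤ × ℤ → ℤ × ℤ × ℤ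
  reflect (m , d , e) = - m , d , e

  reflect-triple : ∀ x → Triple x → Triple (reflect x)
  reflect-triple (m , d , e) (0<d , 0<e , eq) = 0<d , 0<e , trans (identity τ m d e) eq
    where
    identity : ∀ t m d e → - m * - m + t * t * (d * e) ≡ m * m + t * t * (d * e)
    identity = solve-∀

  gap : ℤ × ℤ × ℤ → ℤ
  gap (m , d , e) = e - ρ * m - d

  gap-swap : ∀ x → gap (swap x) ≡ - gap x
  gap-swap (m , d , e) = identity ρ m d e
    where
    identity : ∀ r m d e → d - r * - m - e ≡ - (e - r * m - d)
    identity = solve-∀

  shear : ℤ × ℤ × ℤ → ℤ × ℤ × ℤ
  shear x@(m , d , e) = - m - τ * d , d , gap x

  -- The shear trades the gap for the last entry. Hence it preserves the condition that both are
  -- positive, and applying it twice restores the last entry.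
  gap-shear : ∀ x → gap (shear x) ≡ proj₂ (proj₂ x)
  gap-shear (m , d , e) = modulo _ e (- d) (identity ρ τ m d e)
    where
    identity : ∀ r t m d e → e - r * m - d - r * (- m - t * d) - d ≡ e + (+ 2 - r * t) * - d
    identity = solve-∀

  shear-shear : ∀ x → shear (shear x) ≡ x
  shear-shear x@(m , d , e) = cong₂ (λ m′ e′ → m′ , d , e′) (identity τ m d) (gap-shear x)
    where
    identity : ∀ t m d → - (- m - t * d) - t * d ≡ m
    identity = solve-∀

  shear-triple : ∀ x → Triple x × 0ℤ < gap x → Triple (shear x) × 0ℤ < gap (shear x)
  shear-triple x@(m , d , e) ((0<d , 0<e , eq) , 0<g) =
    (0<d , 0<g , trans (modulo _ (m * m + τ * τ * (d * e)) (τ * m * d) (identity ρ τ m d e)) eq) , subst (0ℤ <_) (sym (gap-shear x)) 0<e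
    where
    identity : ∀ r t m d e → (- m - t * d) * (- m - t * d) + t * t * (d * (e - r * m - d))
                             ≡ m * m + t * t * (d * e) + (+ 2 - r * t) * (t * m * d)
    identity = solve-∀

  G : ℤ × ℤ × ℤ → ℤ
  G (m , d , e) = τ * (d + e) * (τ * d + + 2 * m) * (τ * e - + 2 * m)

  G-swap : ∀ x → G (swap x) ≡ G x
  G-swap (m , d , e) = identity τ m d e
    where
    identity : ∀ t m d e → t * (e + d) * (t * e + + 2 * - m) * (t * d - + 2 * - m)
                           ≡ t * (d + e) * (t * d + + 2 * m) * (t * e - + 2 * m)
    identity = solve-∀

  -- Modulo r t = 2 the factors t (d + e) and t e - 2 m change places, while t d + 2 m is negated.
  G-shear : ∀ x → G (shear x) ≡ - G x
  G-shear (m , d , e) =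
    trans (cong₂ (λ a b → a * (τ * d + + 2 * (- m - τ * d)) * b)
            (modulo _ (τ * e - + 2 * m) m (sumId ρ τ m d e)) (modulo _ (τ * (e + d)) m (lastId ρ τ m d e)))
      (identity τ m d e)
    where
    sumId : ∀ r t m d e → t * (d + (e - r * m - d)) ≡ t * e - + 2 * m + (+ 2 - r * t) * m
    sumId = solve-∀
    lastId : ∀ r t m d e → t * (e - r * m - d) - + 2 * (- m - t * d)
                           ≡ t * (e + d) + (+ 2 - r * t) * m
    lastId = solve-∀
    identity : ∀ t m d e → (t * e - + 2 * m) * (t * d + + 2 * (- m - t * d)) * (t * (e + d))
                           ≡ - (t * (d + e) * (t * d + + 2 * m) * (t * e - + 2 * m))
    identity = solve-∀

  positive : Enumeration (λ x → Triple x × 0ℤ < gap x)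
  positive = restrict triples (λ x → 0ℤ ℤ.<? gap x)

  negative : Enumeration (λ x → Triple x × 0ℤ < gap (swap x))
  negative = restrict triples (λ x → 0ℤ ℤ.<? gap (swap x))

  Balanced : ℤ × ℤ × ℤ → Set
  Balanced x = Triple x × gap x ≡ 0ℤ

  balanced : Enumeration Balanced
  balanced = restrict triples (λ x → gap x ℤ.≟ 0ℤ)

  ∑-positive : ∑ positive G ≡ 0ℤ
  ∑-positive = ∑-involution positive shear shear-triple (λ x _ → shear-shear x) G (λ x _ → G-shear x)

  ∑-negative : ∑ negative G ≡ 0ℤ
  ∑-negative = begin
    ∑ negative G          ≡⟨ ∑-cong negative (λ x _ → G-swap x) ⟨
    ∑ negative (G ∘ swap) ≡⟨ ∑-reindex swapping negative positive G ⟩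
    ∑ positive G          ≡⟨ ∑-positive ⟩
    0ℤ                    ∎
    where
    open ≡-Reasoning
    swapping : Bijection (λ x → Triple x × 0ℤ < gap (swap x)) (λ x → Triple x × 0ℤ < gap x) swap
    swapping = inverse⇒bijection swap swap
      (λ x (p , 0<g) → swap-triple x p , 0<g)
      (λ x (p , 0<g) → swap-triple x p , subst (λ y → 0ℤ < gap y) (sym (swap-swap x)) 0<g)
      (λ x _ → swap-swap x) (λ x _ → swap-swap x)

  -- This is trichotomy for the sign of `gap`: as `swap` negates the gap, `negative` consists of the
  -- triples with negative gap, and both strict cases contribute 0.
  ∑-balanced : ∑ triples G ≡ ∑ balanced G
  ∑-balanced = begin
    ∑ triples G                     ≡⟨ ∑-split triples (λ x → 0ℤ ℤ.<? gap x) G ⟩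
    ∑ positive G + ∑ rest G         ≡⟨ cong₂ _+_ ∑-positive
      (∑-split rest (λ x → 0ℤ ℤ.<? gap (swap x)) G) ⟩
    0ℤ + (∑ rest⁻ G + ∑ rest⁰ G)    ≡⟨ cong (_+_ 0ℤ) (cong₂ _+_
      (trans (∑-unique rest⁻ (reEnumerate (λ {x} (p , g) → (p , disjoint x g) , g) (λ ((p , _) , g) → p , g) negative) G) ∑-negative)
      (∑-unique rest⁰ (reEnumerate (λ {x} (p , eq) → (p , ℤ.≤⇒≯ (ℤ.≤-reflexive eq)) , vanish x eq)
        (λ {x} ((p , ≯) , ≯′) → p , both x ≯ ≯′) balanced) G)) ⟩
    0ℤ + (0ℤ + ∑ balanced G)        ≡⟨ trans (ℤ.+-identityˡ _) (ℤ.+-identityˡ _) ⟩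
    ∑ balanced G                    ∎
    where
    open ≡-Reasoning
    rest  = restrict triples (λ x → ¬? (0ℤ ℤ.<? gap x))
    rest⁻ = restrict rest (λ x → 0ℤ ℤ.<? gap (swap x))
    rest⁰ = restrict rest (λ x → ¬? (0ℤ ℤ.<? gap (swap x)))

    disjoint : ∀ x → 0ℤ < gap (swap x) → ¬ 0ℤ < gap x
    disjoint x 0<g′ 0<g = ℤ.<-asym 0<g (subst (_< 0ℤ) (ℤ.neg-involutive (gap x))
      (ℤ.neg-mono-< (subst (0ℤ <_) (gap-swap x) 0<g′)))

    vanish : ∀ x → gap x ≡ 0ℤ → ¬ 0ℤ < gap (swap x)
    vanish x eq = ℤ.≤⇒≯ (ℤ.≤-reflexive (trans (gap-swap x) (cong -_ eq)))

    both : ∀ x → ¬ 0ℤ < gap x → ¬ 0ℤ < gap (swap x) → gap x ≡ 0ℤ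
    both x ≯ ≯′ with ℤ.<-cmp 0ℤ (gap x)
    ... | tri< 0<g _ _ = contradiction 0<g ≯
    ... | tri≈ _ eq _  = sym eq
    ... | tri> _ _ g<0 = contradiction (subst (0ℤ <_) (sym (gap-swap x)) (ℤ.neg-mono-< g<0)) ≯′

  -- On a triple t² d e = n - m², so the bracket equals n - 5 m², the weight in the recurrence.
  K : ℤ × ℤ × ℤ → ℤ
  K (m , d , e) = (τ * τ * (d * e) - + 4 * (m * m)) * d

  -- Expanding gives G = t (K + K ∘ swap) + O with `O` odd in m. The involution m ↦ - m removes `O`,
  -- and `swap` permutes the triples, so both copies of `K` have the same sum.
  ∑G≡∑K : ∑ triples G ≡ + 2 * τ * ∑ triples K
  ∑G≡∑K = begin
    ∑ triples G                                                ≡⟨ ∑-cong triples (λ (m , d , e) _ → identity τ m d e) ⟩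
    ∑ triples (λ x → (τ * K x + τ * K (swap x)) + O x)         ≡⟨ ∑-plus triples _ O ⟩
    ∑ triples (λ x → τ * K x + τ * K (swap x)) + ∑ triples O   ≡⟨ cong₂ _+_
      (∑-linear triples τ τ K (K ∘ swap)) (∑-involution triples reflect reflect-triple
        (λ (m , d , e) _ → cong (λ m′ → m′ , d , e) (ℤ.neg-involutive m)) O (λ (m , d , e) _ → odd τ m d e)) ⟩
    τ * ∑ triples K + τ * ∑ triples (K ∘ swap) + 0ℤ            ≡⟨ cong (λ s → τ * ∑ triples K + τ * s + 0ℤ)
      (∑-reindex (inverse⇒bijection swap swap swap-triple swap-triple (λ x _ → swap-swap x) (λ x _ → swap-swap x))
        triples triples K) ⟩
    τ * ∑ triples K + τ * ∑ triples K + 0ℤ                     ≡⟨ double τ (∑ triples K) ⟩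
    + 2 * τ * ∑ triples K                                      ∎
    where
    open ≡-Reasoning
    O : ℤ × ℤ × ℤ → ℤ
    O (m , d , e) = + 2 * (τ * τ * (d + e) * m * (e - d))
    identity : ∀ t m d e → t * (d + e) * (t * d + + 2 * m) * (t * e - + 2 * m)
               ≡ t * ((t * t * (d * e) - + 4 * (m * m)) * d) + t * ((t * t * (e * d) - + 4 * (- m * - m)) * e)
                 + + 2 * (t * t * (d + e) * m * (e - d))
    identity = solve-∀
    odd : ∀ t m d e → + 2 * (t * t * (d + e) * - m * (e - d)) ≡ - (+ 2 * (t * t * (d + e) * m * (e - d)))
    odd = solve-∀
    double : ∀ t k → t * k + t * k + 0ℤ ≡ + 2 * t * k
    double = solve-∀

  ∑K≡∑ς : ∑ triples K ≡ ∑ (squares n) (λ (m , k) → (+ n - + 5 * (m * m)) * ς (t ℕ.* t) k)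
  ∑K≡∑ς = begin
    ∑ triples K                             ≡⟨ ∑-image toTriple-bijection decompositions K ⟩
    ∑ decompositions (K ∘ toTriple)         ≡⟨ ∑-cong decompositions (λ x p → weight x p) ⟩
    ∑ decompositions (λ ((m , k) , (d , e)) → (+ n - + 5 * (m * m)) * +[1+ d ])
                                            ≡⟨ ∑-pairs (squares n) (λ (m , k) → factorisations (t ℕ.* t) k) _ ⟩
    ∑ (squares n) (λ (m , k) → ∑ (factorisations (t ℕ.* t) k) (λ (d , e) → (+ n - + 5 * (m * m)) * +[1+ d ]))
      ≡⟨ ∑-cong (squares n) (λ (m , k) _ → ∑-scale (factorisations (t ℕ.* t) k) (+ n - + 5 * (m * m)) _) ⟩
    ∑ (squares n) (λ (m , k) → (+ n - + 5 * (m * m)) * ς (t ℕ.* t) k) ∎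
    where
    open ≡-Reasoning
    identity : ∀ M D d → (D - + 4 * M) * d ≡ (M + D - + 5 * M) * d
    identity = solve-∀
    weight : ∀ x → SquarePlus n (proj₁ x) × Factors (t ℕ.* t) (proj₂ (proj₁ x)) (proj₂ x) →
             K (toTriple x) ≡ (+ n - + 5 * (proj₁ (proj₁ x) * proj₁ (proj₁ x))) * +[1+ proj₁ (proj₂ x) ]
    weight ((m , k) , (d , e)) (eq , refl) = trans
      (identity (m * m) (τ * τ * (+[1+ d ] * +[1+ e ])) +[1+ d ])
      (cong (λ z → (z - + 5 * (m * m)) * +[1+ d ]) (trans (sym (cast m d e)) (cong +_ eq)))

  -- Substituting e = r m + d makes m² + t² d e the square of this number; it is the square root of
  -- n that a balanced triple provides.
  root : ℤ × ℤ × ℤ → ℤ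
  root (m , d , e) = m + τ * d

  last-balanced : ∀ m d e → Balanced (m , d , e) → e ≡ ρ * m + d
  last-balanced m d e bal = trans (identity ρ m d e)
    (trans (cong (λ g → g + ρ * m + d) (proj₂ bal)) (cong (_+ d) (ℤ.+-identityˡ (ρ * m))))
    where
    identity : ∀ r m d e → e ≡ e - r * m - d + r * m + d
    identity = solve-∀

  root-square : ∀ x → Balanced x → root x * root x ≡ + n
  root-square (m , d , e) bal@((_ , _ , eq) , _) =
    trans (modulo _ (m * m + τ * τ * (d * (ρ * m + d))) (τ * m * d) (identity ρ τ m d))
      (trans (cong (λ e → m * m + τ * τ * (d * e)) (sym (last-balanced m d e bal))) eq)
    where
    identity : ∀ r t m d → (m + t * d) * (m + t * d)
                           ≡ m * m + t * t * (d * (r * m + d)) + (+ 2 - r * t) * (t * m * d)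
    identity = solve-∀

  sum-balanced : ∀ m d e → Balanced (m , d , e) → d + e ≡ ρ * root (m , d , e)
  sum-balanced m d e bal = trans (cong (_+_ d) (last-balanced m d e bal))
    (modulo _ (ρ * (m + τ * d)) d (identity ρ τ m d))
    where
    identity : ∀ r t m d → d + (r * m + d) ≡ r * (m + t * d) + (+ 2 - r * t) * d
    identity = solve-∀

  -- Since r times the root is d + e, positivity passes to the root. This excludes the negative
  -- square root of n in `root-unique`.
  root-positive : ∀ x → Balanced x → 0ℤ < root x
  root-positive x@(m , d , e) bal@((0<d , 0<e , _) , _) = ℤ.*-cancelˡ-<-nonNeg ρ
    (subst₂ _<_ (sym (ℤ.*-zeroʳ ρ)) (sum-balanced m d e bal) (ℤ.+-mono-< 0<d 0<e))

  -- Balance means 2 m = t (e - d), which turns the last two factors of `G` into t e and t d.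
  G-balanced : ∀ m d e → Balanced (m , d , e) → G (m , d , e) ≡ τ * τ * τ * (d + e) * (d * e)
  G-balanced m d e bal = begin
    τ * (d + e) * (τ * d + + 2 * m) * (τ * e - + 2 * m)
      ≡⟨ cong (λ a → τ * (d + e) * (τ * d + a) * (τ * e - a)) 2m ⟩
    τ * (d + e) * (τ * d + (τ * e - τ * d)) * (τ * e - (τ * e - τ * d))
      ≡⟨ identity τ d e ⟩
    τ * τ * τ * (d + e) * (d * e) ∎
    where
    open ≡-Reasoning
    identity : ∀ t d e → t * (d + e) * (t * d + (t * e - t * d)) * (t * e - (t * e - t * d))
                         ≡ t * t * t * (d + e) * (d * e)
    identity = solve-∀
    2m-identity : ∀ r t m d → + 2 * m ≡ t * (r * m + d) - t * d + (+ 2 - r * t) * m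
    2m-identity = solve-∀
    2m : + 2 * m ≡ τ * e - τ * d
    2m = trans (modulo _ (τ * (ρ * m + d) - τ * d) m (2m-identity ρ τ m d))
      (cong (λ e → τ * e - τ * d) (sym (last-balanced m d e bal)))

  ∑K-nonsquare : (∀ s → s ℕ.* s ≢ n) → ∑ triples K ≡ 0ℤ
  ∑K-nonsquare nonsquare = ℤ.*-cancelˡ-≡ (+ 2 * τ) _ 0ℤ {{ℤ.i*j≢0 (+ 2) τ}} (begin
    + 2 * τ * ∑ triples K  ≡⟨ ∑G≡∑K ⟨
    ∑ triples G            ≡⟨ ∑-balanced ⟩
    ∑ balanced G           ≡⟨ ∑-zero balanced (λ x bal → contradiction (natural-root x bal) (nonsquare ∣ root x ∣)) ⟩
    0ℤ                     ≡⟨ ℤ.*-zeroʳ (+ 2 * τ) ⟨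
    + 2 * τ * 0ℤ           ∎)
    where
    open ≡-Reasoning
    natural-root : ∀ x → Balanced x → sq (root x) ≡ n
    natural-root x bal = ℤ.+-injective (trans (+sq (root x)) (root-square x bal))

  module _ (s : ℕ) .{{_ : NonZero s}} (n≡s² : n ≡ s ℕ.* s) where

    root-unique : ∀ x → Balanced x → root x ≡ + s
    root-unique x bal = trans (sym (ℤ.0≤i⇒+∣i∣≡i (ℤ.<⇒≤ (root-positive x bal))))
      (cong +_ (square-injective ∣ root x ∣ s
        (ℤ.+-injective (trans (+sq (root x)) (trans (root-square x bal) (cong +_ n≡s²))))))

    private
      -- The common value of d + e on all balanced triples, being r times the root s. So d runs
      -- through 1 , ... , N - 1 and determines both e = N - d and m = s - t d.
      N : ℤ
      N = ρ * + s

      M : ℕ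
      M = ℕ.pred (r ℕ.* s)

      N≡1+M : N ≡ +[1+ M ]
      N≡1+M = trans (sym (ℤ.pos-* r s)) (cong +_ (sym (ℕ.suc-pred (r ℕ.* s) {{ℕ.m*n≢0 r s}})))

      toBalanced : ℕ → ℤ × ℤ × ℤ
      toBalanced d = + s - τ * +[1+ d ] , +[1+ d ] , N - +[1+ d ]

      +n≡s² : + n ≡ + s * + s
      +n≡s² = trans (cong +_ n≡s²) (ℤ.pos-* s s)

      into : ∀ d → d ℕ.< M → Balanced (toBalanced d)
      into d d<M = ( +<+ (s≤s z≤n)
                   , 0<j-i +[1+ d ] N (subst (+[1+ d ] <_) (sym N≡1+M) (+<+ (s≤s d<M)))
                   , trans (modulo _ (+ s * + s) (- (τ * + s * +[1+ d ])) (normId ρ τ (+ s) +[1+ d ])) (sym +n≡s²))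
                 , modulo _ 0ℤ (- +[1+ d ]) (gapId ρ τ (+ s) +[1+ d ])
        where
        normId : ∀ r t s d → (s - t * d) * (s - t * d) + t * t * (d * (r * s - d))
                             ≡ s * s + (+ 2 - r * t) * - (t * s * d)
        normId = solve-∀
        gapId : ∀ r t s d → r * s - d - r * (s - t * d) - d ≡ 0ℤ + (+ 2 - r * t) * - d
        gapId = solve-∀

      onto : ∀ x → Balanced x → ∃[ d ] d ℕ.< M × toBalanced d ≡ x
      onto x@(m , +[1+ d ] , e) bal@((+<+ _ , 0<e , _) , _) =
        d , ℕ.s<s⁻¹ (ℤ.drop‿+<+ (subst (+[1+ d ] <_) N≡1+M (0<j-i⇒i<j +[1+ d ] N (subst (0ℤ <_) e≡ 0<e))))
        , cong₂ (λ m e → m , +[1+ d ] , e) (sym m≡) (sym e≡)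
        where
        addSub : ∀ a b → a ≡ a + b - b
        addSub = solve-∀
        subAdd : ∀ a b → b ≡ a + b - a
        subAdd = solve-∀
        m≡ : m ≡ + s - τ * +[1+ d ]
        m≡ = trans (addSub m (τ * +[1+ d ])) (cong (_- τ * +[1+ d ]) (root-unique x bal))
        e≡ : e ≡ N - +[1+ d ]
        e≡ = trans (subAdd +[1+ d ] e) (cong (_- +[1+ d ])
          (trans (sum-balanced m +[1+ d ] e bal) (cong (ρ *_) (root-unique x bal))))

      toBalanced-bijection : Bijection (ℕ._< M) Balanced toBalanced
      toBalanced-bijection = record
        { into      = into _
        ; injective = λ _ _ eq → ℤ.+[1+-injective (cong (proj₁ ∘ proj₂) eq)
        ; onto      = onto _
        }

    ∑G-square : + 6 * ∑ triples G ≡ τ * τ * τ * N * (N * N * N - N)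
    ∑G-square = begin
      + 6 * ∑ triples G                       ≡⟨ cong (+ 6 *_) (trans ∑-balanced
        (sym (∑-reindex toBalanced-bijection (below M) balanced G))) ⟩
      + 6 * ∑ (below M) (G ∘ toBalanced)      ≡⟨ cong (+ 6 *_) (∑-cong (below M) weight) ⟩
      + 6 * ∑ (below M) (λ d → c * (+[1+ d ] * (N - +[1+ d ])))
                                              ≡⟨ cong (+ 6 *_) (∑-scale (below M) c _) ⟩
      + 6 * (c * S)                           ≡⟨ exchange c S ⟩
      c * (+ 6 * S)                           ≡⟨ cong (c *_) (∑-product-complement N M) ⟩
      c * (+ M * (+ M + + 1) * (+ 3 * N - + 2 * + M - + 1)) ≡⟨ cong (λ M → c * (M * (M + + 1) * (+ 3 * N - + 2 * M - + 1))) M≡N-1 ⟩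
      c * ((N - + 1) * (N - + 1 + + 1) * (+ 3 * N - + 2 * (N - + 1) - + 1)) ≡⟨ closed c N ⟩
      c * (N * N * N - N)                     ∎
      where
      open ≡-Reasoning
      c S : ℤ
      c = τ * τ * τ * N
      S = ∑ (below M) (λ d → +[1+ d ] * (N - +[1+ d ]))
      complement : ∀ N d → d + (N - d) ≡ N
      complement = solve-∀
      weight : ∀ d → d ℕ.< M → G (toBalanced d) ≡ c * (+[1+ d ] * (N - +[1+ d ]))
      weight d d<M = trans (G-balanced _ +[1+ d ] (N - +[1+ d ]) (into d d<M))
        (cong (λ z → τ * τ * τ * z * (+[1+ d ] * (N - +[1+ d ]))) (complement N +[1+ d ]))
      exchange : ∀ c S → + 6 * (c * S) ≡ c * (+ 6 * S)
      exchange = solve-∀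
      minus : ∀ M → M ≡ + 1 + M - + 1
      minus = solve-∀
      M≡N-1 : + M ≡ N - + 1
      M≡N-1 = trans (minus (+ M)) (cong (_- + 1) (sym N≡1+M))
      closed : ∀ c N → c * ((N - + 1) * (N - + 1 + + 1) * (+ 3 * N - + 2 * (N - + 1) - + 1)) ≡ c * (N * N * N - N)
      closed = solve-∀

    -- With N = r s the value of `∑G-square` contains (r t)² = 4, so the common factor 4 t can be
    -- cancelled and only n = s² and r remain.
    ∑K-square : + 3 * ∑ triples K ≡ + n * (ρ * ρ * + n - + 1)
    ∑K-square = ℤ.*-cancelˡ-≡ (+ 4 * τ) _ _ {{ℤ.i*j≢0 (+ 4) τ}} (begin
      + 4 * τ * (+ 3 * ∑ triples K)                     ≡⟨ regroup τ (∑ triples K) ⟩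
      + 6 * (+ 2 * τ * ∑ triples K)                     ≡⟨ cong (+ 6 *_) ∑G≡∑K ⟨
      + 6 * ∑ triples G                                 ≡⟨ ∑G-square ⟩
      τ * τ * τ * N * (N * N * N - N)                   ≡⟨ collect ρ τ (+ s) ⟩
      ρ * τ * (ρ * τ) * τ * (+ s * + s * (ρ * ρ * (+ s * + s) - + 1))
        ≡⟨ cong₂ (λ a b → a * a * τ * (b * (ρ * ρ * b - + 1))) ρτ≡2 (sym +n≡s²) ⟩
      + 2 * + 2 * τ * (+ n * (ρ * ρ * + n - + 1))       ∎)
      where
      open ≡-Reasoning
      regroup : ∀ t k → + 4 * t * (+ 3 * k) ≡ + 6 * (+ 2 * t * k)
      regroup = solve-∀
      collect : ∀ r t s → t * t * t * (r * s) * (r * s * (r * s) * (r * s) - r * s)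
                          ≡ r * t * (r * t) * t * (s * s * (r * r * (s * s) - + 1))
      collect = solve-∀

-- The recurrence for θ⁴, and its verification for Jacobi's formula

δ : ℕ → ℤ
δ zero    = + 1
δ (suc _) = 0ℤ

thetaSum : (ℕ → ℤ) → ℕ → ℤ
thetaSum a n = ∑ (squares n) (λ (m , k) → (+ n - + 5 * (m * m)) * a k)

-- With θ = ∑ q^(m²) and A = ∑ a(k) q^k this says θ · qA′ = 4 A · qθ′, the differential equation of θ⁴.
Recurrent : (ℕ → ℤ) → Set
Recurrent a = ∀ n .{{_ : NonZero n}} → thetaSum a n ≡ 0ℤ

-- In the recurrence at n only m = 0 involves the index n, with the nonzero weight n; all other
-- terms have smaller indices, where the sequences agree by induction.
recurrent-unique : ∀ {a b} → Recurrent a → Recurrent b → a 0 ≡ b 0 → ∀ n → a n ≡ b n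
recurrent-unique {a} {b} reca recb a₀≡b₀ = <-rec _ step
  where
  step : ∀ n → (∀ {k} → k ℕ.< n → a k ≡ b k) → a n ≡ b n
  step zero      ih = a₀≡b₀
  step n@(suc _) ih = ℤ.i-j≡0⇒i≡j (a n) (b n) (ℤ.*-cancelˡ-≡ (+ n) _ 0ℤ (begin
    + n * (a n - b n)                                         ≡⟨ drop (+ n) (a n - b n) ⟨
    (+ n - + 5 * (0ℤ * 0ℤ)) * (a n - b n)                     ≡⟨ ∑-single (squares n) (≡-dec ℤ._≟_ ℕ._≟_) (0ℤ , n) refl
      (λ (m , k) → (+ n - + 5 * (m * m)) * (a k - b k)) vanish ⟨
    ∑ (squares n) (λ (m , k) → (+ n - + 5 * (m * m)) * (a k - b k))
      ≡⟨ ∑-cong (squares n) (λ (m , k) _ → expand (+ n - + 5 * (m * m)) (a k) (b k)) ⟩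
    ∑ (squares n) (λ (m , k) → + 1 * ((+ n - + 5 * (m * m)) * a k) + - + 1 * ((+ n - + 5 * (m * m)) * b k))
      ≡⟨ ∑-linear (squares n) (+ 1) (- + 1) _ _ ⟩
    + 1 * thetaSum a n + - + 1 * thetaSum b n                 ≡⟨ cong₂ (λ u v → + 1 * u + - + 1 * v) (reca n) (recb n) ⟩
    0ℤ                                                        ≡⟨ ℤ.*-zeroʳ (+ n) ⟨
    + n * 0ℤ                                                  ∎))
    where
    open ≡-Reasoning
    drop : ∀ n x → (n - + 5 * (0ℤ * 0ℤ)) * x ≡ n * x
    drop = solve-∀
    expand : ∀ w x y → w * (x - y) ≡ + 1 * (w * x) + - + 1 * (w * y)
    expand = solve-∀
    smaller : ∀ m k → sq m ℕ.+ k ≡ n → (m , k) ≢ (0ℤ , n) → k ℕ.< n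
    smaller (+ zero)  k refl ≢₀ = contradiction refl ≢₀
    smaller +[1+ m ]  k eq   _  = subst (k ℕ.<_) eq (ℕ.m<n+m k (s≤s z≤n))
    smaller -[1+ m ]  k eq   _  = subst (k ℕ.<_) eq (ℕ.m<n+m k (s≤s z≤n))
    vanish : ∀ x → SquarePlus n x → x ≢ (0ℤ , n) → (+ n - + 5 * (proj₁ x * proj₁ x)) * (a (proj₂ x) - b (proj₂ x)) ≡ 0ℤ
    vanish (m , k) eq ≢₀ = trans (cong ((+ n - + 5 * (m * m)) *_) (ℤ.i≡j⇒i-j≡0 (ih (smaller m k eq ≢₀))))
      (ℤ.*-zeroʳ (+ n - + 5 * (m * m)))

thetaSum-δ-nonsquare : ∀ n → (∀ s → s ℕ.* s ≢ n) → thetaSum δ n ≡ 0ℤ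
thetaSum-δ-nonsquare n nonsquare = ∑-zero (squares n) vanish
  where
  vanish : ∀ x → SquarePlus n x → (+ n - + 5 * (proj₁ x * proj₁ x)) * δ (proj₂ x) ≡ 0ℤ
  vanish (m , zero)  eq = contradiction (trans (sym (ℕ.+-identityʳ (sq m))) eq) (nonsquare ∣ m ∣)
  vanish (m , suc k) eq = ℤ.*-zeroʳ (+ n - + 5 * (m * m))

-- Only k = 0 survives. This leaves the two distinct roots m = s and m = - s, each of weight n - 5 n
-- = -4 n.
thetaSum-δ-square : ∀ n s .{{_ : NonZero s}} → n ≡ s ℕ.* s → thetaSum δ n ≡ - + 8 * + n
thetaSum-δ-square n s@(suc s′) n≡s² = begin
  thetaSum δ n                             ≡⟨ ∑-support (squares n) roots (λ (m , k) → sq m ℕ.≟ n ×-dec k ℕ.≟ 0)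
    (λ { {m , k} (eq , refl) → trans (ℕ.+-identityʳ (sq m)) eq }) _ vanish ⟩
  w (+ s) + (w -[1+ s′ ] + 0ℤ)             ≡⟨ cong (λ z → (+ n - + 5 * z) * + 1 + ((+ n - + 5 * z) * + 1 + 0ℤ)) s²≡n ⟩
  (+ n - + 5 * + n) * + 1 + ((+ n - + 5 * + n) * + 1 + 0ℤ) ≡⟨ total (+ n) ⟩
  - + 8 * + n                              ∎
  where
  open ≡-Reasoning
  w : ℤ → ℤ
  w m = (+ n - + 5 * (m * m)) * δ 0
  s²≡n : + s * + s ≡ + n
  s²≡n = trans (sym (ℤ.pos-* s s)) (cong +_ (sym n≡s²))
  total : ∀ n → (n - + 5 * n) * + 1 + ((n - + 5 * n) * + 1 + 0ℤ) ≡ - + 8 * n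
  total = solve-∀
  sound′ : ∀ {x} → x ∈ (+ s , 0) ∷ (-[1+ s′ ] , 0) ∷ [] → sq (proj₁ x) ≡ n × proj₂ x ≡ 0
  sound′ (here refl)         = sym n≡s² , refl
  sound′ (there (here refl)) = sym n≡s² , refl
  complete′ : ∀ {x} → sq (proj₁ x) ≡ n × proj₂ x ≡ 0 → x ∈ (+ s , 0) ∷ (-[1+ s′ ] , 0) ∷ []
  complete′ {m , _} (eq , refl) with square-injective ∣ m ∣ s (trans eq n≡s²)
  complete′ {+ _      , _} (eq , refl) | refl = here refl
  complete′ { -[1+ _ ] , _} (eq , refl) | refl = there (here refl)
  roots : Enumeration (λ (m , k) → sq m ≡ n × k ≡ 0)
  roots = record
    { elements = (+ s , 0) ∷ (-[1+ s′ ] , 0) ∷ []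
    ; unique   = ((λ ()) ∷ []) ∷ [] ∷ []
    ; sound    = sound′
    ; complete = complete′
    }
  vanish : ∀ x → SquarePlus n x → ¬ (sq (proj₁ x) ≡ n × proj₂ x ≡ 0) → (+ n - + 5 * (proj₁ x * proj₁ x)) * δ (proj₂ x) ≡ 0ℤ
  vanish (m , zero)  eq ¬root = contradiction (trans (sym (ℕ.+-identityʳ (sq m))) eq , refl) ¬root
  vanish (m , suc k) eq _     = ℤ.*-zeroʳ (+ n - + 5 * (m * m))

-- The term `δ` accounts for the value 1 at 0, where both divisor sums vanish because 0 has no
-- factorisations.
jacobi : ℕ → ℤ
jacobi k = δ k + (+ 8 * ς 1 k + - + 32 * ς 4 k)

jacobi-recurrent : Recurrent jacobi
jacobi-recurrent n = begin
  thetaSum jacobi n                                                    ≡⟨ ∑-cong (squares n)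
    (λ (m , k) _ → distribute (+ n - + 5 * (m * m)) (δ k) (ς 1 k) (ς 4 k)) ⟩
  ∑ (squares n) (λ (m , k) → let w = + n - + 5 * (m * m) in
    w * δ k + (+ 8 * (w * ς 1 k) + - + 32 * (w * ς 4 k)))              ≡⟨ trans (∑-plus (squares n) _ _)
    (cong (_+_ (thetaSum δ n)) (∑-linear (squares n) (+ 8) (- + 32) _ _)) ⟩
  thetaSum δ n + (+ 8 * thetaSum (ς 1) n + - + 32 * thetaSum (ς 4) n)  ≡⟨ cong₂ (λ u v → thetaSum δ n + (+ 8 * u + - + 32 * v))
    (sym D₁.∑K≡∑ς) (sym D₂.∑K≡∑ς) ⟩
  thetaSum δ n + (+ 8 * K₁ + - + 32 * K₂)                              ≡⟨ cancel (ℕ.anyUpTo? (λ s → s ℕ.* s ℕ.≟ n) (suc n)) ⟩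
  0ℤ                                                                   ∎
  where
  open ≡-Reasoning
  module D₁ = Descent 1 2 refl n
  module D₂ = Descent 2 1 refl n
  K₁ K₂ : ℤ
  K₁ = ∑ D₁.triples D₁.K
  K₂ = ∑ D₂.triples D₂.K
  distribute : ∀ w d x y → w * (d + (+ 8 * x + - + 32 * y)) ≡ w * d + (+ 8 * (w * x) + - + 32 * (w * y))
  distribute = solve-∀

  cancel : Dec (∃[ s ] s ℕ.< suc n × s ℕ.* s ≡ n) → thetaSum δ n + (+ 8 * K₁ + - + 32 * K₂) ≡ 0ℤ
  cancel (no none) = begin
    thetaSum δ n + (+ 8 * K₁ + - + 32 * K₂)  ≡⟨ cong₂ _+_ (thetaSum-δ-nonsquare n nonsquare)
      (cong₂ (λ u v → + 8 * u + - + 32 * v) (D₁.∑K-nonsquare nonsquare) (D₂.∑K-nonsquare nonsquare)) ⟩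
    0ℤ                                       ∎
    where
    nonsquare : ∀ s → s ℕ.* s ≢ n
    -- The search for a root was bounded by n, which suffices because s ≤ s².
    nonsquare s eq = none (s , s≤s (subst (s ℕ.≤_) eq (∣m∣≤sq (+ s))) , eq)
  cancel (yes (s , _ , s²≡n)) = ℤ.*-cancelˡ-≡ (+ 3) _ 0ℤ (begin
    + 3 * (thetaSum δ n + (+ 8 * K₁ + - + 32 * K₂))            ≡⟨ distribute₃ (thetaSum δ n) K₁ K₂ ⟩
    + 3 * thetaSum δ n + (+ 8 * (+ 3 * K₁) + - + 32 * (+ 3 * K₂)) ≡⟨ cong₂ _+_ (cong (_*_ (+ 3)) (thetaSum-δ-square n s (sym s²≡n)))
      (cong₂ (λ u v → + 8 * u + - + 32 * v) (D₁.∑K-square s (sym s²≡n)) (D₂.∑K-square s (sym s²≡n))) ⟩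
    -- Here 4 = r² for t = 1 and 1 = r² for t = 2. The n² terms cancel as 8 · 4 = 32, and the linear
    -- ones as -24 - 8 + 32 = 0.
    + 3 * (- + 8 * + n) + (+ 8 * (+ n * (+ 4 * + n - + 1)) + - + 32 * (+ n * (+ 1 * + n - + 1))) ≡⟨ total (+ n) ⟩
    + 3 * 0ℤ                                                   ∎)
    where
    instance
      s-nonZero : NonZero s
      s-nonZero = ℕ.m*n≢0⇒m≢0 s {s} {{subst NonZero (sym s²≡n) it}}
    distribute₃ : ∀ d x y → + 3 * (d + (+ 8 * x + - + 32 * y)) ≡ + 3 * d + (+ 8 * (+ 3 * x) + - + 32 * (+ 3 * y))
    distribute₃ = solve-∀
    total : ∀ n → + 3 * (- + 8 * n) + (+ 8 * (n * (+ 4 * n - + 1)) + - + 32 * (n * (+ 1 * n - + 1))) ≡ 0ℤ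
    total = solve-∀

-- Counting sums of four squares

normSq : ∀ {j} → Vec ℤ j → ℕ
normSq []      = 0
normSq (m ∷ v) = sq m ℕ.+ normSq v

-- Spheres are built by slicing along the first coordinate, so that a sum over the sphere in ℤ⁵ is
-- already a sum over `squares n` of sums over spheres in ℤ⁴, the shape of `thetaSum`.
sphere : ∀ j n → Enumeration {X = Vec ℤ j} (λ v → normSq v ≡ n)

private
  cons : ∀ {j} → (ℤ × ℕ) × Vec ℤ j → Vec ℤ (suc j)
  cons ((m , _) , v) = m ∷ v

  cons-bijection : ∀ j n → Bijection (λ ((mk , v) : (ℤ × ℕ) × Vec ℤ j) → SquarePlus n mk × normSq v ≡ proj₂ mk)
                                     (λ v → normSq v ≡ n) cons
  cons-bijection j n = record
    { into      = λ { (eq , refl) → eq }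
    ; injective = λ { (_ , refl) (_ , refl) refl → refl }
    ; onto      = λ { {m ∷ v} eq → ((m , normSq v) , v) , (eq , refl) , refl }
    }

  slices : ∀ j n → Enumeration (λ ((mk , v) : (ℤ × ℕ) × Vec ℤ j) → SquarePlus n mk × normSq v ≡ proj₂ mk)
  slices j n = pairs (squares n) (λ (m , k) → sphere j k)

sphere zero zero    = reEnumerate (λ { refl → refl }) (λ { {[]} refl → refl }) (singleton [])
sphere zero (suc n) = record { elements = [] ; unique = [] ; sound = λ () ; complete = λ { {[]} () } }
sphere (suc j) n    = image (cons-bijection j n) (slices j n)

∑-sphere : ∀ j n (h : Vec ℤ (suc j) → ℤ) →
           ∑ (sphere (suc j) n) h ≡ ∑ (squares n) (λ (m , k) → ∑ (sphere j k) (λ v → h (m ∷ v)))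
∑-sphere j n h = trans (∑-image (cons-bijection j n) (slices j n) h)
  (∑-pairs (squares n) (λ (m , k) → sphere j k) (h ∘ cons))

r₄ : ℕ → ℤ
r₄ n = ∑ (sphere 4 n) (λ _ → + 1)

private
  rotate : Vec ℤ 5 → Vec ℤ 5
  rotate (a ∷ b ∷ c ∷ d ∷ e ∷ []) = b ∷ c ∷ d ∷ e ∷ a ∷ []

  ∑-rotate : ∀ n (h : Vec ℤ 5 → ℤ) → ∑ (sphere 5 n) (h ∘ rotate) ≡ ∑ (sphere 5 n) h
  ∑-rotate n h = ∑-reindex bij (sphere 5 n) (sphere 5 n) h
    where
    cyc : ∀ a b c d e → b ℕ.+ (c ℕ.+ (d ℕ.+ (e ℕ.+ (a ℕ.+ 0)))) ≡ a ℕ.+ (b ℕ.+ (c ℕ.+ (d ℕ.+ (e ℕ.+ 0))))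
    cyc = ℕRing.solve-∀
    normSq-rotate : ∀ v → normSq (rotate v) ≡ normSq v
    normSq-rotate (a ∷ b ∷ c ∷ d ∷ e ∷ []) = cyc (sq a) (sq b) (sq c) (sq d) (sq e)
    bij : Bijection (λ v → normSq v ≡ n) (λ v → normSq v ≡ n) rotate
    bij = record
      { into      = λ {v} eq → trans (normSq-rotate v) eq
      ; injective = λ { {_ ∷ _ ∷ _ ∷ _ ∷ _ ∷ []} {_ ∷ _ ∷ _ ∷ _ ∷ _ ∷ []} _ _ refl → refl }
      ; onto      = λ { {b ∷ c ∷ d ∷ e ∷ a ∷ []} eq →
                        (a ∷ b ∷ c ∷ d ∷ e ∷ []) , trans (sym (normSq-rotate (a ∷ b ∷ c ∷ d ∷ e ∷ []))) eq , refl }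
      }

r₄-recurrent : Recurrent r₄
r₄-recurrent n = begin
  thetaSum r₄ n              ≡⟨ ∑-cong (squares n) (λ (m , k) _ → sym (trans
    (∑-cong (sphere 4 k) (λ _ _ → sym (ℤ.*-identityʳ (+ n - + 5 * (m * m)))))
    (∑-scale (sphere 4 k) (+ n - + 5 * (m * m)) (λ _ → + 1)))) ⟩
  ∑ (squares n) (λ (m , k) → ∑ (sphere 4 k) (λ v → h (m ∷ v))) ≡⟨ ∑-sphere 4 n h ⟨
  ∑ (sphere 5 n) h           ≡⟨ ℤ.*-cancelˡ-≡ (+ 5) _ 0ℤ fivefold ⟩
  0ℤ                         ∎
  where
  open ≡-Reasoning
  h : Vec ℤ 5 → ℤ
  h (m ∷ _) = + n - + 5 * (m * m)
  Σ₅ : (Vec ℤ 5 → ℤ) → ℤ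
  Σ₅ = ∑ (sphere 5 n)
  five : ∀ x → + 5 * x ≡ x + (x + (x + (x + x)))
  five = solve-∀
  vanish : ∀ v → normSq v ≡ n →
           h v + (h (rotate v) + (h (rotate (rotate v)) + (h (rotate (rotate (rotate v)))
             + h (rotate (rotate (rotate (rotate v))))))) ≡ 0ℤ
  vanish (a ∷ b ∷ c ∷ d ∷ e ∷ []) eq =
    trans (cong (λ n → (n - + 5 * (a * a)) + ((n - + 5 * (b * b)) + ((n - + 5 * (c * c))
                        + ((n - + 5 * (d * d)) + (n - + 5 * (e * e)))))) n≡)
      (identity a b c d e)
    where
    n≡ : + n ≡ a * a + (b * b + (c * c + (d * d + (e * e + 0ℤ))))
    n≡ = trans (cong +_ (sym eq)) (cong₂ _+_ (+sq a) (cong₂ _+_ (+sq b) (cong₂ _+_ (+sq c)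
           (cong₂ _+_ (+sq d) (cong (_+ 0ℤ) (+sq e))))))
    identity : ∀ a b c d e → let n = a * a + (b * b + (c * c + (d * d + (e * e + 0ℤ)))) in
      (n - + 5 * (a * a)) + ((n - + 5 * (b * b)) + ((n - + 5 * (c * c))
        + ((n - + 5 * (d * d)) + (n - + 5 * (e * e))))) ≡ 0ℤ
    identity = solve-∀
  h₁ h₂ h₃ h₄ : Vec ℤ 5 → ℤ
  h₁ = h ∘ rotate
  h₂ = h₁ ∘ rotate
  h₃ = h₂ ∘ rotate
  h₄ = h₃ ∘ rotate
  ∑h₁ : Σ₅ h₁ ≡ Σ₅ h
  ∑h₁ = ∑-rotate n h
  ∑h₂ : Σ₅ h₂ ≡ Σ₅ h
  ∑h₂ = trans (∑-rotate n h₁) ∑h₁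
  ∑h₃ : Σ₅ h₃ ≡ Σ₅ h
  ∑h₃ = trans (∑-rotate n h₂) ∑h₂
  ∑h₄ : Σ₅ h₄ ≡ Σ₅ h
  ∑h₄ = trans (∑-rotate n h₃) ∑h₃
  fivefold : + 5 * Σ₅ h ≡ + 5 * 0ℤ
  fivefold = begin
    + 5 * Σ₅ h                                     ≡⟨ five (Σ₅ h) ⟩
    Σ₅ h + (Σ₅ h + (Σ₅ h + (Σ₅ h + Σ₅ h)))         ≡⟨ cong (_+_ (Σ₅ h)) (cong₂ _+_ ∑h₁ (cong₂ _+_ ∑h₂ (cong₂ _+_ ∑h₃ ∑h₄))) ⟨
    Σ₅ h + (Σ₅ h₁ + (Σ₅ h₂ + (Σ₅ h₃ + Σ₅ h₄)))     ≡⟨ sum₅ ⟨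
    Σ₅ (λ v → h v + (h₁ v + (h₂ v + (h₃ v + h₄ v)))) ≡⟨ ∑-zero (sphere 5 n) vanish ⟩
    0ℤ                                             ∎
    where
    sum₅ : Σ₅ (λ v → h v + (h₁ v + (h₂ v + (h₃ v + h₄ v)))) ≡ Σ₅ h + (Σ₅ h₁ + (Σ₅ h₂ + (Σ₅ h₃ + Σ₅ h₄)))
    sum₅ = trans (∑-plus E h _) (cong (_+_ (Σ₅ h)) (trans (∑-plus E h₁ _) (cong (_+_ (Σ₅ h₁))
             (trans (∑-plus E h₂ _) (cong (_+_ (Σ₅ h₂)) (∑-plus E h₃ h₄))))))
      where
      E = sphere 5 n

r₄≡jacobi : ∀ n → r₄ n ≡ jacobi n
-- The initial condition is settled by evaluation: both sequences compute to 1 at 0.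
r₄≡jacobi = recurrent-unique r₄-recurrent jacobi-recurrent refl

-- Divisor sums, dilations and rational arguments

pos-sum : (f : X → ℕ) (xs : List X) → + sum (map f xs) ≡ ∑ˡ xs (λ x → + f x)
pos-sum f []       = refl
pos-sum f (x ∷ xs) = cong (_+_ (+ f x)) (pos-sum f xs)

positives : (n : ℕ) → Enumeration (λ d → 1 ℕ.≤ d × d ℕ.≤ n)
positives n = record
  { elements = [1⋯ n ]
  ; unique   = Unique.applyUpTo⁺₁ suc n (λ i<j _ eq → ℕ.<⇒≢ i<j (ℕ.suc-injective eq))
  ; sound    = λ d∈ → let i , i<n , eq = ∈-applyUpTo⁻ suc d∈ in
                 subst (λ d → 1 ℕ.≤ d × d ℕ.≤ n) (sym eq) (s≤s z≤n , i<n)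
  ; complete = λ { {suc i} (_ , i<n) → ∈-applyUpTo⁺ suc i<n }
  }

ς₁≡σ : ∀ n → ς 1 n ≡ + σ n
ς₁≡σ n = begin
  ς 1 n                  ≡⟨ ∑-reindex bij (factorisations 1 n) divisors (λ d → + d) ⟩
  ∑ divisors (λ d → + d)          ≡⟨ pos-sum id (elements divisors) ⟨
  + sum (map id (elements divisors)) ≡⟨ cong (λ xs → + sum xs) (map-id (elements divisors)) ⟩
  + σ n                  ∎
  where
  open ≡-Reasoning
  Divisor : ℕ → Set
  Divisor d = (1 ℕ.≤ d × d ℕ.≤ n) × d ∣ n
  divisors : Enumeration Divisor
  divisors = restrict (positives n) (_∣? n)
  comm : ∀ d e → 1 ℕ.* (d ℕ.* e) ≡ e ℕ.* d
  comm = ℕRing.solve-∀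
  into : ∀ {x} → Factors 1 n x → Divisor (suc (proj₁ x))
  into {d , e} eq = (s≤s z≤n , subst (suc d ℕ.≤_) n≡ (ℕ.m≤n*m (suc d) (suc e))) , divides (suc e) (sym n≡)
    where
    n≡ : suc e ℕ.* suc d ≡ n
    n≡ = trans (sym (comm (suc d) (suc e))) eq
  injective : ∀ {x y} → Factors 1 n x → Factors 1 n y → suc (proj₁ x) ≡ suc (proj₁ y) → x ≡ y
  injective {d , e} {_ , e′} eq eq′ refl = cong (_,_ d)
    (ℕ.suc-injective (ℕ.*-cancelˡ-≡ (suc e) (suc e′) (suc d) (ℕ.*-cancelˡ-≡ _ _ 1 (trans eq (sym eq′)))))
  onto : ∀ {d} → Divisor d → ∃[ x ] Factors 1 n x × suc (proj₁ x) ≡ d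
  -- A zero cofactor would make n = 0, but n is at least the divisor d + 1.
  onto {suc d} ((_ , d≤n) , divides zero    eq) = contradiction (subst (suc d ℕ.≤_) eq d≤n) λ ()
  onto {suc d} ((_ , d≤n) , divides (suc e) eq) = (d , e) , trans (comm (suc d) (suc e)) (sym eq) , refl
  bij : Bijection (Factors 1 n) Divisor (λ (d , _) → suc d)
  bij = record { into = into ; injective = injective ; onto = onto }

multiples : (c : ℕ) .{{_ : NonZero c}} (n : ℕ) → Enumeration (λ k → c ℕ.* k ≡ n)
multiples c n = reEnumerate proj₂ (λ {k} eq → s≤s (subst (k ℕ.≤_) eq (ℕ.m≤n*m k c)) , eq)
  (restrict (below (suc n)) (λ k → c ℕ.* k ℕ.≟ n))

-- This is f(n / c), read as 0 unless c divides n, since there is at most one term. Written as a sum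
-- it merges with other sums through `∑-pairs`, without a case distinction on divisibility.
dilate : (c : ℕ) .{{_ : NonZero c}} → (ℕ → ℤ) → ℕ → ℤ
dilate c f n = ∑ (multiples c n) f

dilate-at : ∀ c .{{_ : NonZero c}} (f : ℕ → ℤ) k {n} → c ℕ.* k ≡ n → dilate c f n ≡ f k
dilate-at c f k {n} eq = ∑-single (multiples c n) ℕ._≟_ k eq f
  (λ k′ eq′ k′≢k → contradiction (ℕ.*-cancelˡ-≡ k′ k c (trans eq′ (sym eq))) k′≢k)

dilate-id : ∀ f n → dilate 1 f n ≡ f n
dilate-id f n = dilate-at 1 f n (ℕ.*-identityˡ n)

dilate-dilate : ∀ c d .{{_ : NonZero c}} .{{_ : NonZero d}} f n →
                dilate c (dilate d f) n ≡ dilate (c ℕ.* d) {{ℕ.m*n≢0 c d}} f n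
dilate-dilate c d f n = trans (sym (∑-pairs (multiples c n) (multiples d) (f ∘ proj₂)))
  (∑-reindex bij (pairs (multiples c n) (multiples d)) (multiples (c ℕ.* d) {{ℕ.m*n≢0 c d}} n) f)
  where
  bij : Bijection (λ (k , l) → c ℕ.* k ≡ n × d ℕ.* l ≡ k) (λ l → c ℕ.* d ℕ.* l ≡ n) proj₂
  bij = record
    { into      = λ { {_ , l} (eq , refl) → trans (ℕ.*-assoc c d l) eq }
    ; injective = λ { (_ , refl) (_ , refl) refl → refl }
    ; onto      = λ {l} eq → (d ℕ.* l , l) , (trans (sym (ℕ.*-assoc c d l)) eq , refl) , refl
    }

ς-dilate : ∀ c .{{_ : NonZero c}} n → ς c n ≡ dilate c (ς 1) n
ς-dilate c n = sym (trans (sym (∑-pairs (multiples c n) (factorisations 1) _))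
  (∑-reindex bij (pairs (multiples c n) (factorisations 1)) (factorisations c n) _))
  where
  bij : Bijection (λ (k , x) → c ℕ.* k ≡ n × Factors 1 k x) (Factors c n) proj₂
  bij = record
    { into      = λ { {_ , d , e} (eq , refl) → trans (cong (c ℕ.*_) (sym (ℕ.*-identityˡ _))) eq }
    ; injective = λ { (_ , refl) (_ , refl) refl → refl }
    ; onto      = λ {x} eq → (1 ℕ.* (suc (proj₁ x) ℕ.* suc (proj₂ x)) , x)
                    , (trans (cong (c ℕ.*_) (ℕ.*-identityˡ _)) eq , refl) , refl
    }

-- Cross-multiplication, numerator times c equals n times denominator, is all that is needed about
-- the normalised quotient; the cases then follow the clauses of `zeroExtend`.
zeroExtend-dilate : ∀ (f : ℕ → ℕ) c .{{_ : NonZero c}} n .{{_ : NonZero n}} →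
                    + zeroExtend f (+ n / c) ≡ dilate c (λ k → + f k) n
zeroExtend-dilate f c n = extend (+ n / c) (begin
  ↥ q * + c          ≡⟨ cong (↥ q *_) (↧-/ (+ n) c) ⟨
  ↥ q * (↧ q * g)    ≡⟨ exchange (↥ q) (↧ q) g ⟩
  ↥ q * g * ↧ q      ≡⟨ cong (_* ↧ q) (↥-/ (+ n) c) ⟩
  + n * ↧ q          ∎)
  where
  open ≡-Reasoning
  q : ℚ
  q = + n / c
  g : ℤ
  g = ℤ.gcd (+ n) (+ c)
  exchange : ∀ a b g → a * (b * g) ≡ a * g * b
  exchange = solve-∀
  extend : ∀ q → ↥ q * + c ≡ + n * ↧ q → + zeroExtend f q ≡ dilate c (λ k → + f k) n
  extend (mkℚ +[1+ k ] zero _) eq = sym (dilate-at c (λ k → + f k) (suc k) (ℤ.+-injective (begin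
    + (c ℕ.* suc k)   ≡⟨ cong +_ (ℕ.*-comm c (suc k)) ⟩
    + (suc k ℕ.* c)   ≡⟨ ℤ.pos-* (suc k) c ⟩
    +[1+ k ] * + c    ≡⟨ eq ⟩
    + n * + 1         ≡⟨ ℤ.*-identityʳ (+ n) ⟩
    + n               ∎)))
  -- If c l = n, the numerator k + 1 is l (d + 2), so the denominator d + 2 ≥ 2 divides the
  -- numerator, against lowest terms. Coprimality is an irrelevant field, so it may only be used to
  -- derive a contradiction through `⊥-elim-irr`.
  extend (mkℚ +[1+ k ] (suc d) coprime) eq = sym (∑-zero (multiples c n) (λ l cl≡n →
    ⊥-elim-irr (absurd (coprime {suc (suc d)} (divides l (k≡ l cl≡n) , divides 1 (sym (ℕ.*-identityˡ _)))))))
    where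
    absurd : suc (suc d) ≢ 1
    absurd ()
    rearrange : ∀ c l d → c ℕ.* l ℕ.* d ≡ l ℕ.* d ℕ.* c
    rearrange = ℕRing.solve-∀
    k≡ : ∀ l → c ℕ.* l ≡ n → suc k ≡ l ℕ.* suc (suc d)
    k≡ l cl≡n = ℕ.*-cancelʳ-≡ (suc k) (l ℕ.* suc (suc d)) c (trans
      (ℤ.+-injective (trans (ℤ.pos-* (suc k) c) (trans eq (sym (ℤ.pos-* n (suc (suc d)))))))
      (trans (cong (ℕ._* suc (suc d)) (sym cl≡n)) (rearrange c l (suc (suc d)))))
  extend (mkℚ (+ 0) d _) eq = contradiction (ℤ.i*j≡0⇒i≡0∨j≡0 (+ n) (sym eq)) λ
    { (inj₁ n≡0) → ℕ.≢-nonZero⁻¹ n (ℤ.+-injective n≡0) ; (inj₂ ()) }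
  extend (mkℚ -[1+ k ] d _) eq = contradiction (trans eq (sym (ℤ.pos-* n (suc d)))) (negative k c _)
    where
    negative : ∀ k c .{{_ : NonZero c}} m → -[1+ k ] * + c ≢ + m
    negative k (suc c) m ()

-- Convolutions along a l + b m = n

module _ (a b : ℕ) .{{_ : NonZero a}} .{{_ : NonZero b}} where

  Solution : ℕ → ℕ × ℕ → Set
  Solution n (l , m) = a ℕ.* l ℕ.+ b ℕ.* m ≡ n

  solution-bound : ∀ n l m → Solution n (l , m) → l ℕ.≤ n × m ℕ.≤ n
  solution-bound n l m refl = ℕ.≤-trans (ℕ.m≤n*m l a) (ℕ.m≤m+n _ _) , ℕ.≤-trans (ℕ.m≤n*m m b) (ℕ.m≤n+m _ _)

  solutions : ∀ n → Enumeration (Solution n)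
  solutions n = boundedPairs (suc n) (λ (l , m) → a ℕ.* l ℕ.+ b ℕ.* m ℕ.≟ n)
    (λ {l} {m} eq → let l≤n , m≤n = solution-bound n l m eq in s≤s l≤n , s≤s m≤n)

  convolve : (ℕ → ℤ) → (ℕ → ℤ) → ℕ → ℤ
  convolve f g n = ∑ (solutions n) (λ (l , m) → f l * g m)

  convolve-linearˡ : ∀ x y f₀ f₁ f₂ g n → convolve (λ l → f₀ l + (x * f₁ l + y * f₂ l)) g n
                     ≡ convolve f₀ g n + (x * convolve f₁ g n + y * convolve f₂ g n)
  convolve-linearˡ x y f₀ f₁ f₂ g n = begin
    convolve (λ l → f₀ l + (x * f₁ l + y * f₂ l)) g n      ≡⟨ ∑-cong (solutions n)
      (λ (l , m) _ → distribute x y (f₀ l) (f₁ l) (f₂ l) (g m)) ⟩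
    ∑ (solutions n) (λ (l , m) → f₀ l * g m + (x * (f₁ l * g m) + y * (f₂ l * g m))) ≡⟨ ∑-plus (solutions n) _ _ ⟩
    convolve f₀ g n + ∑ (solutions n) (λ (l , m) → x * (f₁ l * g m) + y * (f₂ l * g m))
      ≡⟨ cong (_+_ (convolve f₀ g n)) (∑-linear (solutions n) x y _ _) ⟩
    convolve f₀ g n + (x * convolve f₁ g n + y * convolve f₂ g n) ∎
    where
    open ≡-Reasoning
    distribute : ∀ x y u v w z → (u + (x * v + y * w)) * z ≡ u * z + (x * (v * z) + y * (w * z))
    distribute = solve-∀

  convolve-δˡ : ∀ g n → convolve δ g n ≡ dilate b g n
  convolve-δˡ g n = begin
    convolve δ g n                                  ≡⟨ ∑-support (solutions n) (image axis (multiples b n))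
      (λ (l , m) → l ℕ.≟ 0 ×-dec b ℕ.* m ℕ.≟ n) (λ { {_ , m} (refl , eq) → trans (cong (ℕ._+ b ℕ.* m) (ℕ.*-zeroʳ a)) eq }) _ vanish ⟩
    ∑ (image axis (multiples b n)) (λ (l , m) → δ l * g m) ≡⟨ ∑-image axis (multiples b n) _ ⟩
    ∑ (multiples b n) (λ m → + 1 * g m)             ≡⟨ ∑-cong (multiples b n) (λ m _ → ℤ.*-identityˡ (g m)) ⟩
    dilate b g n                                    ∎
    where
    open ≡-Reasoning
    axis : Bijection (λ m → b ℕ.* m ≡ n) (λ (l , m) → l ≡ 0 × b ℕ.* m ≡ n) (_,_ 0)
    axis = record
      { into      = λ eq → refl , eq
      ; injective = λ { _ _ refl → refl }
      ; onto      = λ { {_ , m} (refl , eq) → m , eq , refl }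
      }
    vanish : ∀ x → Solution n x → ¬ (proj₁ x ≡ 0 × b ℕ.* proj₂ x ≡ n) → δ (proj₁ x) * g (proj₂ x) ≡ 0ℤ
    vanish (zero  , m) eq ¬axis = contradiction (refl , trans (sym (cong (ℕ._+ b ℕ.* m) (ℕ.*-zeroʳ a))) eq) ¬axis
    vanish (suc l , m) eq _     = refl

  -- The additional pairs with l = 0 or m = 0 contribute nothing, as `σ 0` evaluates to 0.
  W≡convolve : ∀ n → + W a b n ≡ convolve (λ k → + σ k) (λ k → + σ k) n
  W≡convolve n = begin
    + W a b n                                               ≡⟨ pos-sum (λ (l , m) → σ l ℕ.* σ m) (elements positive) ⟩
    ∑ positive (λ (l , m) → + (σ l ℕ.* σ m))                ≡⟨ ∑-cong positive (λ (l , m) _ → ℤ.pos-* (σ l) (σ m)) ⟩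
    ∑ positive (λ (l , m) → + σ l * + σ m)                  ≡⟨ ∑-support (solutions n) positive′
      (λ (l , m) → (1 ℕ.≤? l ×-dec 1 ℕ.≤? m) ×-dec (a ℕ.* l ℕ.+ b ℕ.* m ℕ.≟ n)) proj₂ _ vanish ⟨
    convolve (λ k → + σ k) (λ k → + σ k) n                  ∎
    where
    open ≡-Reasoning
    positive : Enumeration (λ (l , m) → ((1 ℕ.≤ l × l ℕ.≤ n) × (1 ℕ.≤ m × m ℕ.≤ n)) × Solution n (l , m))
    positive = record
      { elements = filter (λ (l , m) → a ℕ.* l ℕ.+ b ℕ.* m ℕ.≟ n) (cartesianProduct [1⋯ n ] [1⋯ n ])
      ; unique   = Unique.filter⁺ _ (Unique.cartesianProduct⁺ (unique (positives n)) (unique (positives n)))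
      ; sound    = λ x∈ → let x∈box , eq = ∈-filter⁻ _ {xs = cartesianProduct [1⋯ n ] [1⋯ n ]} x∈
                              l∈ , m∈    = ∈-cartesianProduct⁻ [1⋯ n ] [1⋯ n ] x∈box
                          in (sound (positives n) l∈ , sound (positives n) m∈) , eq
      ; complete = λ ((l∈ , m∈) , eq) → ∈-filter⁺ _
                     (∈-cartesianProduct⁺ (complete (positives n) l∈) (complete (positives n) m∈)) eq
      }
    positive′ : Enumeration (λ (l , m) → (1 ℕ.≤ l × 1 ℕ.≤ m) × Solution n (l , m))
    positive′ = reEnumerate (λ (((1≤l , _) , (1≤m , _)) , eq) → (1≤l , 1≤m) , eq)
      (λ { {l , m} ((1≤l , 1≤m) , eq) → let l≤n , m≤n = solution-bound n l m eq in
                                        ((1≤l , l≤n) , (1≤m , m≤n)) , eq })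
      positive
    vanish : ∀ x → Solution n x → ¬ ((1 ℕ.≤ proj₁ x × 1 ℕ.≤ proj₂ x) × Solution n x) →
             + σ (proj₁ x) * + σ (proj₂ x) ≡ 0ℤ
    vanish (zero  , m)     _  _  = refl
    vanish (suc l , zero)  _  _  = ℤ.*-zeroʳ (+ σ (suc l))
    vanish (suc l , suc m) eq ¬p = contradiction ((s≤s z≤n , s≤s z≤n) , eq) ¬p

module _ (a b : ℕ) .{{_ : NonZero a}} .{{_ : NonZero b}} where

  convolve-comm : ∀ f g n → convolve a b f g n ≡ convolve b a g f n
  convolve-comm f g n = trans (∑-cong (solutions a b n) (λ (l , m) _ → ℤ.*-comm (f l) (g m)))
    (∑-reindex (inverse⇒bijection Product.swap Product.swap (λ (l , m) → trans (ℕ.+-comm (b ℕ.* m) (a ℕ.* l)))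
      (λ (m , l) → trans (ℕ.+-comm (a ℕ.* l) (b ℕ.* m))) (λ _ _ → refl) (λ _ _ → refl))
      (solutions a b n) (solutions b a n) (λ (m , l) → g m * f l))

  module _ (c : ℕ) .{{_ : NonZero c}} where

    private instance
      ac-nonZero : NonZero (a ℕ.* c)
      ac-nonZero = ℕ.m*n≢0 a c
      ca-nonZero : NonZero (c ℕ.* a)
      ca-nonZero = ℕ.m*n≢0 c a
      cb-nonZero : NonZero (c ℕ.* b)
      cb-nonZero = ℕ.m*n≢0 c b

    -- Only multiples l = c k contribute, and a l = (a c) k.
    convolve-dilateˡ : ∀ f g n → convolve a b (dilate c f) g n ≡ convolve (a ℕ.* c) b f g n
    convolve-dilateˡ f g n = begin
      convolve a b (dilate c f) g n                     ≡⟨ ∑-cong (solutions a b n) (λ (l , m) _ →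
        trans (ℤ.*-comm (dilate c f l) (g m)) (trans (sym (∑-scale (multiples c l) (g m) f))
          (∑-cong (multiples c l) (λ k _ → ℤ.*-comm (g m) (f k))))) ⟩
      ∑ (solutions a b n) (λ (l , m) → ∑ (multiples c l) (λ k → f k * g m)) ≡⟨ ∑-pairs (solutions a b n) (λ (l , m) → multiples c l) _ ⟨
      ∑ (pairs (solutions a b n) (λ (l , m) → multiples c l)) (λ ((l , m) , k) → f k * g m)
        ≡⟨ ∑-reindex bij (pairs (solutions a b n) (λ (l , m) → multiples c l)) (solutions (a ℕ.* c) b n) (λ (k , m) → f k * g m) ⟩
      convolve (a ℕ.* c) b f g n                        ∎
      where
      open ≡-Reasoning
      bij : Bijection (λ ((l , m) , k) → a ℕ.* l ℕ.+ b ℕ.* m ≡ n × c ℕ.* k ≡ l)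
                      (λ (k , m) → a ℕ.* c ℕ.* k ℕ.+ b ℕ.* m ≡ n) (λ ((_ , m) , k) → k , m)
      bij = record
        { into      = λ { {(_ , m) , k} (eq , refl) → trans (cong (ℕ._+ b ℕ.* m) (ℕ.*-assoc a c k)) eq }
        ; injective = λ { (_ , refl) (_ , refl) refl → refl }
        ; onto      = λ { {k , m} eq → ((c ℕ.* k , m) , k)
                        , (trans (sym (cong (ℕ._+ b ℕ.* m) (ℕ.*-assoc a c k))) eq , refl) , refl }
        }

    dilate-convolve : ∀ f g n → dilate c (convolve a b f g) n ≡ convolve (c ℕ.* a) (c ℕ.* b) f g n
    dilate-convolve f g n = trans (sym (∑-pairs (multiples c n) (solutions a b) _))
      (∑-reindex bij (pairs (multiples c n) (solutions a b)) (solutions (c ℕ.* a) (c ℕ.* b) n) (λ (l , m) → f l * g m))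
      where
      factor : ∀ c a b l m → c ℕ.* a ℕ.* l ℕ.+ c ℕ.* b ℕ.* m ≡ c ℕ.* (a ℕ.* l ℕ.+ b ℕ.* m)
      factor = ℕRing.solve-∀
      bij : Bijection (λ (k , (l , m)) → c ℕ.* k ≡ n × a ℕ.* l ℕ.+ b ℕ.* m ≡ k)
                      (λ (l , m) → c ℕ.* a ℕ.* l ℕ.+ c ℕ.* b ℕ.* m ≡ n) proj₂
      bij = record
        { into      = λ { {_ , (l , m)} (eq , refl) → trans (factor c a b l m) eq }
        ; injective = λ { (_ , refl) (_ , refl) refl → refl }
        ; onto      = λ { {l , m} eq → (a ℕ.* l ℕ.+ b ℕ.* m , (l , m))
                        , (trans (sym (factor c a b l m)) eq , refl) , refl }
        }

module _ (a b c : ℕ) .{{_ : NonZero a}} .{{_ : NonZero b}} .{{_ : NonZero c}} where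

  private instance
    bc-nonZero : NonZero (b ℕ.* c)
    bc-nonZero = ℕ.m*n≢0 b c

  convolve-dilateʳ : ∀ f g n → convolve a b f (dilate c g) n ≡ convolve a (b ℕ.* c) f g n
  convolve-dilateʳ f g n = begin
    convolve a b f (dilate c g) n     ≡⟨ convolve-comm a b f (dilate c g) n ⟩
    convolve b a (dilate c g) f n     ≡⟨ convolve-dilateˡ b a c g f n ⟩
    convolve (b ℕ.* c) a g f n        ≡⟨ convolve-comm (b ℕ.* c) a g f n ⟩
    convolve a (b ℕ.* c) f g n        ∎
    where open ≡-Reasoning

module _ (a b : ℕ) .{{_ : NonZero a}} .{{_ : NonZero b}} where

  convolve-δʳ : ∀ f n → convolve a b f δ n ≡ dilate a f n
  convolve-δʳ f n = trans (convolve-comm a b f δ n) (convolve-δˡ b a f n)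

  convolve-linearʳ : ∀ x y f g₀ g₁ g₂ n → convolve a b f (λ m → g₀ m + (x * g₁ m + y * g₂ m)) n
                     ≡ convolve a b f g₀ n + (x * convolve a b f g₁ n + y * convolve a b f g₂ n)
  convolve-linearʳ x y f g₀ g₁ g₂ n = begin
    convolve a b f (λ m → g₀ m + (x * g₁ m + y * g₂ m)) n ≡⟨ convolve-comm a b f _ n ⟩
    convolve b a (λ m → g₀ m + (x * g₁ m + y * g₂ m)) f n ≡⟨ convolve-linearˡ b a x y g₀ g₁ g₂ f n ⟩
    convolve b a g₀ f n + (x * convolve b a g₁ f n + y * convolve b a g₂ f n)
      ≡⟨ cong₂ _+_ (convolve-comm a b f g₀ n) (cong₂ (λ u v → x * u + y * v) (convolve-comm a b f g₁ n) (convolve-comm a b f g₂ n)) ⟨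
    convolve a b f g₀ n + (x * convolve a b f g₁ n + y * convolve a b f g₂ n) ∎
    where open ≡-Reasoning

-- Counting the representations

count↔ : {P : X → Set} (E : Enumeration P) → (∀ {x} (p q : P x) → p ≡ q) →
         Σ X P ↔ Fin (length (elements E))
count↔ {P = P} E irrelevant = mk↔ₛ′
  (λ (x , p) → index (complete E p))
  (λ i → lookup (elements E) i , sound E (∈-lookup i))
  (λ i → index-lookup (unique E) i (complete E (sound E (∈-lookup i))))
  (λ (x , p) → pair≡ (sym (lookup-index (complete E p))))
  where
  pair≡ : ∀ {x y} {p : P x} {q : P y} → x ≡ y → (x , p) ≡ (y , q)
  pair≡ refl = cong (_,_ _) (irrelevant _ _)
  -- In a list without repetitions membership proofs are unique, so the proof returned by `complete`
  -- must point to the position i that was looked up.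
  index-lookup : ∀ {xs : List X} → Unique xs → ∀ i (x∈ : lookup xs i ∈ xs) → index x∈ ≡ i
  index-lookup u i x∈ = trans (cong index (unique⇒irrelevant u x∈ (∈-lookup i))) (index-∈-lookup i)
    where
    index-∈-lookup : ∀ {xs : List X} (i : Fin (length xs)) → index (∈-lookup {xs = xs} i) ≡ i
    index-∈-lookup {xs = _ ∷ xs} Fin.zero    = refl
    index-∈-lookup {xs = _ ∷ xs} (Fin.suc i) = cong Fin.suc (index-∈-lookup i)

∑-count : {P : X → Set} (E : Enumeration P) → ∑ E (λ _ → + 1) ≡ + length (elements E)
∑-count E = go (elements E)
  where
  go : ∀ xs → ∑ˡ xs (λ _ → + 1) ≡ + length xs
  go []       = refl
  go (x ∷ xs) = cong (_+_ (+ 1)) (go xs)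

module _ (n : ℕ) where

  private
    Splitting : (ℕ × ℕ) × (Vec ℤ 4 × Vec ℤ 4) → Set
    Splitting ((l , m) , (v , w)) = 1 ℕ.* l ℕ.+ 7 ℕ.* m ≡ n × normSq v ≡ l × normSq w ≡ m

    splittings : Enumeration Splitting
    splittings = pairs (solutions 1 7 n) (λ (l , m) → pairs (sphere 4 l) (λ _ → sphere 4 m))

    join : (ℕ × ℕ) × (Vec ℤ 4 × Vec ℤ 4) → Vec ℤ 8
    join (_ , (v , w)) = v Vec.++ w

    form₇-join : ∀ (v w : Vec ℤ 4) → form₇ (v Vec.++ w) ≡ + (1 ℕ.* normSq v ℕ.+ 7 ℕ.* normSq w)
    form₇-join (a ∷ b ∷ c ∷ d ∷ []) (e ∷ f ∷ g ∷ h ∷ []) = begin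
      a ^ 2 + b ^ 2 + c ^ 2 + d ^ 2 + + 7 * (e ^ 2 + f ^ 2 + g ^ 2 + h ^ 2) ≡⟨ regroup a b c d e f g h ⟩
      (a * a + (b * b + (c * c + (d * d + 0ℤ)))) + + 7 * (e * e + (f * f + (g * g + (h * h + 0ℤ))))
        ≡⟨ cong₂ (λ x y → x + + 7 * y) (cast a b c d) (cast e f g h) ⟨
      + normSq v + + 7 * + normSq w               ≡⟨ cong₂ _+_ (cong +_ (sym (ℕ.*-identityˡ (normSq v)))) (sym (ℤ.pos-* 7 (normSq w))) ⟩
      + (1 ℕ.* normSq v ℕ.+ 7 ℕ.* normSq w)       ∎
      where
      open ≡-Reasoning
      v w : Vec ℤ 4
      v = a ∷ b ∷ c ∷ d ∷ []
      w = e ∷ f ∷ g ∷ h ∷ []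
      cast : ∀ a b c d → + normSq (a ∷ b ∷ c ∷ d ∷ []) ≡ a * a + (b * b + (c * c + (d * d + 0ℤ)))
      cast a b c d = cong₂ _+_ (+sq a) (cong₂ _+_ (+sq b) (cong₂ _+_ (+sq c) (cong (_+ 0ℤ) (+sq d))))
      -- The left side is `form₇` with each `x ^ 2` unfolded to `x * (x * + 1)`, which makes it a
      -- polynomial identity for the solver.
      regroup : ∀ a b c d e f g h → a * (a * + 1) + b * (b * + 1) + c * (c * + 1) + d * (d * + 1)
                  + + 7 * (e * (e * + 1) + f * (f * + 1) + g * (g * + 1) + h * (h * + 1))
                ≡ (a * a + (b * b + (c * c + (d * d + 0ℤ)))) + + 7 * (e * e + (f * f + (g * g + (h * h + 0ℤ))))
      regroup = solve-∀

    join-bijection : Bijection Splitting (λ x → + n ≡ form₇ x) join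
    join-bijection = record
      { into      = λ { {_ , (v , w)} (eq , refl , refl) → trans (cong +_ (sym eq)) (sym (form₇-join v w)) }
      ; injective = injective
      ; onto      = onto
      }
      where
      injective : ∀ {x y} → Splitting x → Splitting y → join x ≡ join y → x ≡ y
      injective {_ , (_ ∷ _ ∷ _ ∷ _ ∷ [] , _)} {_ , (_ ∷ _ ∷ _ ∷ _ ∷ [] , _)} (_ , refl , refl) (_ , refl , refl) refl = refl
      onto : ∀ {x} → + n ≡ form₇ x → ∃[ y ] Splitting y × join y ≡ x
      onto {a ∷ b ∷ c ∷ d ∷ w} eq =
        ((normSq v , normSq w) , (v , w)) , (ℤ.+-injective (sym (trans eq (form₇-join v w))) , refl , refl) , refl
        where
        v : Vec ℤ 4
        v = a ∷ b ∷ c ∷ d ∷ []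

  representations₇ : Enumeration (λ x → + n ≡ form₇ x)
  representations₇ = image join-bijection splittings

  ∑-representations₇ : ∑ representations₇ (λ _ → + 1) ≡ convolve 1 7 r₄ r₄ n
  ∑-representations₇ = begin
    ∑ representations₇ (λ _ → + 1)       ≡⟨ ∑-image join-bijection splittings (λ _ → + 1) ⟩
    ∑ splittings (λ _ → + 1)             ≡⟨ ∑-pairs (solutions 1 7 n) (λ (l , m) → pairs (sphere 4 l) (λ _ → sphere 4 m)) _ ⟩
    ∑ (solutions 1 7 n) (λ (l , m) → ∑ (pairs (sphere 4 l) (λ _ → sphere 4 m)) (λ _ → + 1))
      ≡⟨ ∑-cong (solutions 1 7 n) (λ (l , m) _ → trans (∑-pairs (sphere 4 l) (λ _ → sphere 4 m) (λ _ → + 1))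
        (trans (trans (∑-cong (sphere 4 l) (λ _ _ → sym (ℤ.*-identityʳ (r₄ m)))) (∑-scale (sphere 4 l) (r₄ m) (λ _ → + 1)))
          (ℤ.*-comm (r₄ m) (r₄ l)))) ⟩
    convolve 1 7 r₄ r₄ n                 ∎
    where open ≡-Reasoning

-- Expanding the convolution of Jacobi's formula with itself

module _ (n : ℕ) .{{_ : NonZero n}} where

  private
    s τ F : ℕ → ℤ
    s k = + σ k
    τ   = dilate 4 s
    F k = δ k + (+ 8 * s k + - + 32 * τ k)

    r₄≡F : ∀ k → r₄ k ≡ F k
    r₄≡F k = trans (r₄≡jacobi k) (cong (_+_ (δ k)) (cong₂ (λ x y → + 8 * x + - + 32 * y) (ς₁≡σ k)
      (trans (ς-dilate 4 k) (∑-cong (multiples 4 k) (λ l _ → ς₁≡σ l)))))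

    C : (ℕ → ℤ) → (ℕ → ℤ) → ℤ
    C f g = convolve 1 7 f g n

    Cδδ : C δ δ ≡ 0ℤ
    Cδδ = trans (convolve-δˡ 1 7 δ n) (∑-zero (multiples 7 n) λ
      { zero eq → contradiction (sym eq) (ℕ.≢-nonZero⁻¹ n) ; (suc _) _ → refl })

    Cδτ : C δ τ ≡ + zeroExtend σ (+ n / 28)
    Cδτ = trans (convolve-δˡ 1 7 τ n) (trans (dilate-dilate 7 4 s n) (sym (zeroExtend-dilate σ 28 n)))

    -- Both arguments are multiples of 4, and 4 l + 28 m = n says that l + 7 m = n / 4.
    Cττ : C τ τ ≡ + zeroExtend (W 1 7) (+ n / 4)
    Cττ = begin
      C τ τ                                  ≡⟨ convolve-dilateˡ 1 7 4 s τ n ⟩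
      convolve 4 7 s τ n                     ≡⟨ convolve-dilateʳ 4 7 4 s s n ⟩
      convolve 4 28 s s n                    ≡⟨ dilate-convolve 1 7 4 s s n ⟨
      dilate 4 (convolve 1 7 s s) n          ≡⟨ ∑-cong (multiples 4 n) (λ k _ → W≡convolve 1 7 k) ⟨
      dilate 4 (λ k → + W 1 7 k) n           ≡⟨ zeroExtend-dilate (W 1 7) 4 n ⟨
      + zeroExtend (W 1 7) (+ n / 4)         ∎
      where open ≡-Reasoning

    -- Bilinearity yields nine convolutions. Their values are parameters, so that each can be
    -- replaced by its divisor sum or `W` in the same step.
    expand : ∀ {δδ δs δτ sδ ss sτ τδ τs ττ} →
             C δ δ ≡ δδ → C δ s ≡ δs → C δ τ ≡ δτ → C s δ ≡ sδ → C s s ≡ ss → C s τ ≡ sτ →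
             C τ δ ≡ τδ → C τ s ≡ τs → C τ τ ≡ ττ →
             C F F ≡ δδ + (+ 8 * δs + - + 32 * δτ)
                     + (+ 8 * (sδ + (+ 8 * ss + - + 32 * sτ)) + - + 32 * (τδ + (+ 8 * τs + - + 32 * ττ)))
    expand refl refl refl refl refl refl refl refl refl =
      trans (convolve-linearˡ 1 7 (+ 8) (- + 32) δ s τ F n)
        (cong₂ _+_ (right δ) (cong₂ (λ x y → + 8 * x + - + 32 * y) (right s) (right τ)))
      where
      right : ∀ f → C f F ≡ C f δ + (+ 8 * C f s + - + 32 * C f τ)
      right f = convolve-linearʳ 1 7 (+ 8) (- + 32) f δ s τ n

  convolve-r₄ : convolve 1 7 r₄ r₄ n ≡
    + 8 * + σ n
    - + 32 * + zeroExtend σ (+ n / 4)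
    + + 8 * + zeroExtend σ (+ n / 7)
    - + 32 * + zeroExtend σ (+ n / 28)
    + + 64 * + W 1 7 n
    + + 1024 * + zeroExtend (W 1 7) (+ n / 4)
    - + 256 * (+ W 4 7 n + + W 1 28 n)
  convolve-r₄ = begin
    convolve 1 7 r₄ r₄ n  ≡⟨ ∑-cong (solutions 1 7 n) (λ (l , m) _ → cong₂ _*_ (r₄≡F l) (r₄≡F m)) ⟩
    C F F                 ≡⟨ expand Cδδ
      (trans (convolve-δˡ 1 7 s n) (sym (zeroExtend-dilate σ 7 n)))
      Cδτ
      (trans (convolve-δʳ 1 7 s n) (dilate-id s n))
      (sym (W≡convolve 1 7 n))
      (trans (convolve-dilateʳ 1 7 4 s s n) (sym (W≡convolve 1 28 n)))
      (trans (convolve-δʳ 1 7 τ n) (trans (dilate-id τ n) (sym (zeroExtend-dilate σ 4 n))))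
      (trans (convolve-dilateˡ 1 7 4 s s n) (sym (W≡convolve 4 7 n)))
      Cττ ⟩
    -- The constants of the theorem arise here: 64 = 8², 1024 = 32², and -256 = 8 · (-32) for each
    -- of the two mixed terms.
    _                     ≡⟨ collect (+ σ n) (+ zeroExtend σ (+ n / 4)) (+ zeroExtend σ (+ n / 7)) (+ zeroExtend σ (+ n / 28))
      (+ W 1 7 n) (+ zeroExtend (W 1 7) (+ n / 4)) (+ W 4 7 n) (+ W 1 28 n) ⟩
    _                     ∎
    where
    open ≡-Reasoning
    collect : ∀ σ₁ σ₄ σ₇ σ₂₈ w₁₇ w₁₇′ w₄₇ w₁₂₈ →
      0ℤ + (+ 8 * σ₇ + - + 32 * σ₂₈)
        + (+ 8 * (σ₁ + (+ 8 * w₁₇ + - + 32 * w₁₂₈)) + - + 32 * (σ₄ + (+ 8 * w₄₇ + - + 32 * w₁₇′)))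
      ≡ + 8 * σ₁ - + 32 * σ₄ + + 8 * σ₇ - + 32 * σ₂₈ + + 64 * w₁₇ + + 1024 * w₁₇′ - + 256 * (w₄₇ + w₁₂₈)
    collect = solve-∀

theorem3p2 : (n : ℕ) .{{_ : NonZero n}} →
    ∃[ r ] (R₇ n is r) ×
    + r ≡ + 8 * + σ n
    - + 32 * + zeroExtend σ (+ n / 4)
    + + 8 * + zeroExtend σ (+ n / 7)
    - + 32 * + zeroExtend σ (+ n / 28)
    + + 64 * + W 1 7 n
    + + 1024 * + zeroExtend (W 1 7) (+ n / 4)
    - + 256 * (+ W 4 7 n + + W 1 28 n)
theorem3p2 n =
  length (elements (representations₇ n)) ,
  count↔ (representations₇ n) ≡-irrelevant ,
  trans (sym (∑-count (representations₇ n))) (trans (∑-representations₇ n) (convolve-r₄ n))
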